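{- For every integer $d\ge 1$, $$P_d=\sum_{\delta\in \mathrm{PCom}^*_{\mathrm{dyad}}(d)} (-1)^{\ell(\delta)-1} L(\delta)\, E_\delta^+.$$
   Context: A composition of $n\ge 0$ is a finite tuple of positive integers with sum $n$; its length $\ell$ is the number of entries. A polycomposition of $n$ is a sequence $\delta=(\alpha^{(1)},\alpha^{(2)},\dots)$ of (possibly empty) compositions with $\sum_{i\ge1} i|\alpha^{(i)}|=n$, where $|\alpha|$ is the sum of the entries of $\alpha$; write $\delta|^i=\alpha^{(i)}$ and $\ell(\delta)=\sum_i\ell(\delta|^i)$. Each part $d$ of $\delta|^r$ gives a block $d^r$ of $\delta$ (degree $d$, multiplicity $r$; not exponentiation). $\mathrm{PCom}^*_{\mathrm{dyad}}(d)$ is the set of singular dyadic polycompositions of $d$: those having exactly one multiplicity, which must be a power of $2$; i.e. $\delta=(d_1,\dots,d_k)^{r}$ with $r=2^m$, $m\ge0$, $k\ge1$, $d_i\ge 1$ and $r(d_1+\cdots+d_k)=d$. For such $\delta$, $\ell(\delta)=k$ and $L(\delta)=r\,d_k$. Let $x_{i,j}$ ($i,j\ge 1$) be indeterminates with $\deg x_{i,j}=i$; all series have rational coefficients. A monomial is square-free if every exponent is at most $1$. $E^+_d$ is the sum of all square-free monomials of degree $d$, and for $d\ge1$, $P_d=\sum_{k\mid d}\sum_{j\ge1} k\,x_{k,j}^{d/k}$, with $k$ ranging over positive divisors of $d$. For a block $d^r$, $E^+_{d^r}$ is obtained from $E^+_d$ by replacing each $x_{i,j}$ by $x_{i,j}^r$,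 and $E^+_\delta=\prod E^+_{d^r}$ over all blocks $d^r$ of $\delta$ (counted with repetition). -}

module Defs where

open import Data.Fin.Base using (Fin; toℕ)
open import Data.Fin.Properties using (toℕ<n)
open import Data.Integer.Base as ℤ using (ℤ; +_)
open import Data.List.Base
  using (List; []; _∷_; [_]; _++_; map; foldr; length; replicate; upTo;
         applyUpTo; allFin; filter; concat; cartesianProductWith)
open import Data.List.Membership.Propositional using (_∈_)
open import Data.List.Membership.Propositional.Properties
  using (∈-++⁺ˡ; ∈-++⁺ʳ; ∈-++⁻; ∈-map⁺; ∈-map⁻; ∈-concat⁺′; ∈-concat⁻′;
         ∈-filter⁺; ∈-filter⁻; ∈-upTo⁺)
open import Data.List.NonEmpty as List⁺ using (List⁺; _∷_; _∷⁺_; toList)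
open import Data.List.Relation.Binary.Pointwise as Pointwise
  using (Pointwise; []; _∷_)
open import Data.List.Relation.Unary.All as All using (All; []; _∷_)
import Data.List.Relation.Unary.All.Properties as All
open import Data.List.Relation.Unary.AllPairs as AllPairs using ([]; _∷_)
import Data.List.Relation.Unary.AllPairs.Properties as AllPairs
open import Data.List.Relation.Unary.Any using (here; there)
open import Data.List.Relation.Unary.Unique.Propositional using (Unique)
import Data.List.Relation.Unary.Unique.Propositional.Properties as Unique
open import Data.Nat.Base as ℕ
  using (ℕ; zero; suc; pred; _+_; _*_; _∸_; _^_; _⊔_; _≤_; _<_; z≤n; s≤s;
         NonZero)
open import Data.Nat.Divisibility using (_∣_; _∣?_; divides)
open import Data.Nat.DivMod using (_/_; m/n*n≡m; m*n/n≡m; m≥n⇒m/n>0; 0/n≡0)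
open import Data.Nat.ListAction using (sum)
import Data.Nat.Properties as ℕ
open import Data.Product.Base using (_×_; _,_; proj₁; proj₂; ∃)
open import Data.Rational.Base as ℚ using (ℚ; 0ℚ; 1ℚ)
import Data.Rational.Properties as ℚ
open import Data.Sum.Base using (inj₁; inj₂)
open import Function.Base using (_∘_)
open import Function.Bundles using (_⇔_; mk⇔; module Equivalence)
open import Relation.Binary.Definitions using (Decidable)
open import Relation.Binary.PropositionalEquality
  using (_≡_; _≢_; refl; sym; trans; cong; cong₂; subst)
open import Relation.Nullary using (¬_; Dec; yes; no; contradiction)
open import Relation.Nullary.Decidable using (map′; _×-dec_)

private variable
  A : Set

-- A list stands for the sequence that continues with z beyond its end.
nth : A → List A → ℕ → A
nth z []       _       = z
nth z (x ∷ xs) zero    = x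
nth z (x ∷ xs) (suc i) = nth z xs i

nth-map : ∀ {z : A} (f : A → A) → f z ≡ z → ∀ xs i →
          nth z (map f xs) i ≡ f (nth z xs i)
nth-map f fz []       i       = sym fz
nth-map f fz (x ∷ xs) zero    = refl
nth-map f fz (x ∷ xs) (suc i) = nth-map f fz xs i

nth⇒All : ∀ {P : A → Set} {z} xs → (∀ i → P (nth z xs i)) → All P xs
nth⇒All []       p = []
nth⇒All (x ∷ xs) p = p 0 ∷ nth⇒All xs (p ∘ suc)

All⇒nth : ∀ {P : A → Set} {z xs} → P z → All P xs → ∀ i → P (nth z xs i)
All⇒nth pz []       i       = pz
All⇒nth pz (p ∷ ps) zero    = p
All⇒nth pz (p ∷ ps) (suc i) = All⇒nth pz ps i

Padded : (A → A → Set) → A → List A → List A → Set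
Padded _~_ z xs ys = ∀ i → nth z xs i ~ nth z ys i

padded? : ∀ {_~_ : A → A → Set} {z} → z ~ z → Decidable _~_ →
          Decidable (Padded _~_ z)
padded? {_~_ = _~_} {z} z~z _~?_ = go
  where
  uncons : ∀ xs ys → nth z xs 0 ~ nth z ys 0 →
           (∀ i → nth z xs (suc i) ~ nth z ys (suc i)) → Padded _~_ z xs ys
  uncons xs ys p ps zero    = p
  uncons xs ys p ps (suc i) = ps i

  step : ∀ xs ys → Dec (∀ i → nth z xs (suc i) ~ nth z ys (suc i)) →
         Dec (Padded _~_ z xs ys)
  step xs ys d = map′ (λ (p , ps) → uncons xs ys p ps) (λ p → p 0 , p ∘ suc)
                      ((nth z xs 0 ~? nth z ys 0) ×-dec d)

  go : Decidable (Padded _~_ z)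
  go []       []       = yes (λ _ → z~z)
  go []       (y ∷ ys) = step [] (y ∷ ys) (go [] ys)
  go (x ∷ xs) []       = step (x ∷ xs) [] (go xs [])
  go (x ∷ xs) (y ∷ ys) = step (x ∷ xs) (y ∷ ys) (go xs ys)

consBoth : A × A → List A × List A → List A × List A
consBoth (a , b) (as , bs) = a ∷ as , b ∷ bs

splitList : (A → List (A × A)) → List A → List (List A × List A)
splitList s []       = [ ([] , []) ]
splitList s (x ∷ xs) = cartesianProductWith consBoth (s x) (splitList s xs)

Both : (A → A → Set) → A × A → A × A → Set
Both _~_ (a , b) (c , d) = (a ~ c) × (b ~ d)

module _ {_~_ : A → A → Set} {z : A} {s : A → List (A × A)}
         (z~z : z ~ z) (sz : s z ≡ [ (z , z) ])
         (s-cong : ∀ {x y} → x ~ y → Pointwise (Both _~_) (s x) (s y)) where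

  private
    _≋_ : List A → List A → Set
    _≋_ = Padded _~_ z

    cons : ∀ {x y xs ys} → x ~ y → xs ≋ ys → (x ∷ xs) ≋ (y ∷ ys)
    cons p ps zero    = p
    cons p ps (suc i) = ps i

    product : ∀ {us vs} {uss vss : List (List A × List A)} →
              Pointwise (Both _~_) us vs → Pointwise (Both _≋_) uss vss →
              Pointwise (Both _≋_) (cartesianProductWith consBoth us uss)
                                   (cartesianProductWith consBoth vs vss)
    product []                   qs = []
    product ((p₁ , p₂) ∷ ps) qs = Pointwise.++⁺
      (Pointwise.map⁺ _ _ (Pointwise.map (λ (q₁ , q₂) → cons p₁ q₁ , cons p₂ q₂) qs))
      (product ps qs)

    unpad : ∀ {uss} → Pointwise (Both _≋_) [ ([ z ] , [ z ]) ] uss →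
            Pointwise (Both _≋_) [ ([] , []) ] uss
    unpad ((p , q) ∷ []) = ((λ { zero → p 0 ; (suc i) → p (suc i) }) ,
                            (λ { zero → q 0 ; (suc i) → q (suc i) })) ∷ []

    unpadʳ : ∀ {uss} → Pointwise (Both _≋_) uss [ ([ z ] , [ z ]) ] →
             Pointwise (Both _≋_) uss [ ([] , []) ]
    unpadʳ ((p , q) ∷ []) = ((λ { zero → p 0 ; (suc i) → p (suc i) }) ,
                             (λ { zero → q 0 ; (suc i) → q (suc i) })) ∷ []

    pad : cartesianProductWith consBoth (s z) [ ([] , []) ] ≡ [ ([ z ] , [ z ]) ]
    pad = cong (λ us → cartesianProductWith consBoth us [ ([] , []) ]) sz

  splitList-cong : ∀ {xs ys} → xs ≋ ys →
                   Pointwise (Both _≋_) (splitList s xs) (splitList s ys)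
  splitList-cong {[]}     {[]}     p = ((λ _ → z~z) , (λ _ → z~z)) ∷ []
  splitList-cong {[]}     {y ∷ ys} p =
    unpad (subst (λ l → Pointwise (Both _≋_) l (splitList s (y ∷ ys))) pad
                 (product (s-cong (p 0)) (splitList-cong {[]} {ys} (p ∘ suc))))
  splitList-cong {x ∷ xs} {[]}     p =
    unpadʳ (subst (Pointwise (Both _≋_) (splitList s (x ∷ xs))) pad
                  (product (s-cong (p 0)) (splitList-cong {xs} {[]} (p ∘ suc))))
  splitList-cong {x ∷ xs} {y ∷ ys} p =
    product (s-cong (p 0)) (splitList-cong {xs} {ys} (p ∘ suc))

-- A monomial in the x_{i,j}.  Indices are shifted by one: entry j of row i of a monomial is the
-- exponent of x_{i+1,j+1}.  Entries beyond the end are 0, so the same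
-- monomial has several representatives, identified by _≈_.
Monomial : Set
Monomial = List (List ℕ)

exponent : Monomial → ℕ → ℕ → ℕ
exponent m i j = nth 0 (nth [] m i) j

infix 4 _≈_ _≈?_

_≈_ : Monomial → Monomial → Set
m ≈ n = ∀ i j → exponent m i j ≡ exponent n i j

_≈?_ : Decidable _≈_
_≈?_ = padded? (λ _ → refl) (padded? refl ℕ._≟_)

degreeFrom : ℕ → Monomial → ℕ
degreeFrom i []        = 0
degreeFrom i (row ∷ m) = i * sum row + degreeFrom (suc i) m

degree : Monomial → ℕ
degree = degreeFrom 1

AllExponents : (ℕ → Set) → Monomial → Set
AllExponents P = All (All P)

SquareFree : Monomial → Set
SquareFree = AllExponents (_≤ 1)

squareFree? : ∀ m → Dec (SquareFree m)
squareFree? = All.all? (All.all? (ℕ._≤? 1))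

-- The monomial x_{i+1,j+1} ^ e.
variablePower : ℕ → ℕ → ℕ → Monomial
variablePower i j e = replicate i [] ++ [ replicate j 0 ++ [ e ] ]

splitℕ : ℕ → List (ℕ × ℕ)
splitℕ e = map (λ a → a , e ∸ a) (upTo (suc e))

-- The pairs (u , v) with u v = m, each listed once.
factorisations : Monomial → List (Monomial × Monomial)
factorisations = splitList (splitList splitℕ)

width : Monomial → ℕ
width m = foldr _⊔_ 0 (map length m)

sum-cong : ∀ xs ys → Padded _≡_ 0 xs ys → sum xs ≡ sum ys
sum-cong []       []       p = refl
sum-cong []       (y ∷ ys) p = cong₂ _+_ (p 0) (sum-cong [] ys (p ∘ suc))
sum-cong (x ∷ xs) []       p = cong₂ _+_ (p 0) (sum-cong xs [] (p ∘ suc))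
sum-cong (x ∷ xs) (y ∷ ys) p = cong₂ _+_ (p 0) (sum-cong xs ys (p ∘ suc))

degreeFrom-cong : ∀ k m n → m ≈ n → degreeFrom k m ≡ degreeFrom k n
degreeFrom-cong k []      []      p = refl
degreeFrom-cong k []      (r ∷ n) p = trans (sym (ℕ.*-zeroʳ k))
  (trans (sym (ℕ.+-identityʳ (k * 0)))
    (cong₂ _+_ (cong (k *_) (sum-cong [] r (p 0)))
               (degreeFrom-cong (suc k) [] n (p ∘ suc))))
degreeFrom-cong k (r ∷ m) []      p =
  trans (cong₂ _+_ (cong (k *_) (sum-cong r [] (p 0)))
                   (degreeFrom-cong (suc k) m [] (p ∘ suc)))
    (trans (ℕ.+-identityʳ (k * 0)) (ℕ.*-zeroʳ k))
degreeFrom-cong k (r ∷ m) (s ∷ n) p =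
  cong₂ _+_ (cong (k *_) (sum-cong r s (p 0))) (degreeFrom-cong (suc k) m n (p ∘ suc))

AllExponents-resp : ∀ {P} → P 0 → ∀ {m n} → m ≈ n → AllExponents P m → AllExponents P n
AllExponents-resp {P} p₀ {m} {n} m≈n ps = nth⇒All n λ i → nth⇒All (nth [] n i) λ j →
  subst P (m≈n i j) (All⇒nth p₀ (All⇒nth [] ps i) j)

factorisations-cong : ∀ m n → m ≈ n →
  Pointwise (Both _≈_) (factorisations m) (factorisations n)
factorisations-cong m n = splitList-cong {_~_ = Padded _≡_ 0} {z = []} {s = splitList splitℕ} (λ _ → refl) refl
  (λ {x} {y} → splitList-cong {_~_ = _≡_} {z = 0} {s = splitℕ} refl refl
    (λ { refl → Pointwise.refl (refl , refl) }) {x} {y}) {m} {n}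

exponent-map : ∀ (f : ℕ → ℕ) → f 0 ≡ 0 → ∀ m i j →
               exponent (map (map f) m) i j ≡ f (exponent m i j)
exponent-map f f0 m i j = trans
  (cong (λ row → nth 0 row j) (nth-map (map f) refl m i))
  (nth-map f f0 (nth [] m i) j)

exponent-variablePower : ∀ i j e → exponent (variablePower i j e) i j ≡ e
exponent-variablePower zero    zero    e = refl
exponent-variablePower zero    (suc j) e = exponent-variablePower zero j e
exponent-variablePower (suc i) j       e = exponent-variablePower i j e

exponent-width : ∀ m i j → width m ≤ j → exponent m i j ≡ 0
exponent-width []      i       j       _ = refl
exponent-width (r ∷ m) zero    j       w = beyond r j (ℕ.≤-trans (ℕ.m≤m⊔n (length r) _) w)
  where
  beyond : ∀ r j → length r ≤ j → nth 0 r j ≡ 0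
  beyond []      j       _       = refl
  beyond (_ ∷ r) (suc j) (s≤s w) = beyond r j w
exponent-width (r ∷ m) (suc i) j       w =
  exponent-width m i j (ℕ.≤-trans (ℕ.m≤n⊔m (length r) _) w)

record Series : Set where
  field
    coeff      : Monomial → ℚ
    coeff-cong : ∀ m n → m ≈ n → coeff m ≡ coeff n

open Series public

infix  4 _≋_
infixl 7 _·_ _•_

_≋_ : Series → Series → Set
f ≋ g = ∀ m → coeff f m ≡ coeff g m

sumℚ : List ℚ → ℚ
sumℚ = foldr ℚ._+_ 0ℚ

indicator : ∀ {P : Set} → Dec P → ℚ
indicator (yes _) = 1ℚ
indicator (no _)  = 0ℚ

indicator-cong : ∀ {P Q : Set} (P? : Dec P) (Q? : Dec Q) → (P → Q) → (Q → P) →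
                 indicator P? ≡ indicator Q?
indicator-cong (yes _) (yes _) f g = refl
indicator-cong (yes p) (no ¬q) f g = contradiction (f p) ¬q
indicator-cong (no ¬p) (yes q) f g = contradiction (g q) ¬p
indicator-cong (no _)  (no _)  f g = refl

monomial : Monomial → Series
monomial u .coeff m = indicator (m ≈? u)
monomial u .coeff-cong m n m≈n = indicator-cong (m ≈? u) (n ≈? u)
  (λ p i j → trans (sym (m≈n i j)) (p i j)) (λ p i j → trans (m≈n i j) (p i j))

one : Series
one = monomial []

_•_ : ℚ → Series → Series
(c • f) .coeff m        = c ℚ.* coeff f m
(c • f) .coeff-cong m n m≈n = cong (c ℚ.*_) (coeff-cong f m n m≈n)

_·_ : Series → Series → Series
(f · g) .coeff m = sumℚ (map (λ (u , v) → coeff f u ℚ.* coeff g v) (factorisations m))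
(f · g) .coeff-cong m n m≈n = go (factorisations-cong m n m≈n)
  where
  go : ∀ {us vs} → Pointwise (Both _≈_) us vs →
       sumℚ (map (λ (u , v) → coeff f u ℚ.* coeff g v) us) ≡
       sumℚ (map (λ (u , v) → coeff f u ℚ.* coeff g v) vs)
  go []             = refl
  go ((p , q) ∷ ps) =
    cong₂ ℚ._+_ (cong₂ ℚ._*_ (coeff-cong f _ _ p) (coeff-cong g _ _ q)) (go ps)

∑ : List A → (A → Series) → Series
∑ xs f .coeff m = sumℚ (map (λ x → coeff (f x) m) xs)
∑ xs f .coeff-cong m n m≈n = go xs
  where
  go : ∀ xs → sumℚ (map (λ x → coeff (f x) m) xs) ≡ sumℚ (map (λ x → coeff (f x) n) xs)
  go []       = refl
  go (x ∷ xs) = cong₂ ℚ._+_ (coeff-cong (f x) m n m≈n) (go xs)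

∏ : List Series → Series
∏ = foldr _·_ one

sum-truncate : ∀ (g : ℕ → ℚ) b n → (∀ j → b ≤ j → g j ≡ 0ℚ) → b ≤ n →
               sumℚ (applyUpTo g b) ≡ sumℚ (applyUpTo g n)
sum-truncate g zero    zero    z b≤n       = refl
sum-truncate g zero    (suc n) z b≤n       = trans (sym (ℚ.+-identityˡ 0ℚ))
  (cong₂ ℚ._+_ (sym (z 0 z≤n)) (sum-truncate (g ∘ suc) 0 n (λ j _ → z (suc j) z≤n) z≤n))
sum-truncate g (suc b) (suc n) z (s≤s b≤n) =
  cong (g 0 ℚ.+_) (sum-truncate (g ∘ suc) b n (λ j b≤j → z (suc j) (s≤s b≤j)) b≤n)

-- The sum of a sequence of series in which each monomial occurs only
-- finitely often.
∑∞ : (f : ℕ → Series) (bound : Monomial → ℕ) →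
     (∀ m j → bound m ≤ j → coeff (f j) m ≡ 0ℚ) → Series
∑∞ f bound vanish .coeff m = sumℚ (applyUpTo (λ j → coeff (f j) m) (bound m))
∑∞ f bound vanish .coeff-cong m n m≈n =
  trans (sum-truncate _ (bound m) (bound m ⊔ bound n) (vanish m) (ℕ.m≤m⊔n _ _))
    (trans (go (λ j → coeff-cong (f j) m n m≈n) (bound m ⊔ bound n))
      (sym (sum-truncate _ (bound n) (bound m ⊔ bound n) (vanish n) (ℕ.m≤n⊔m _ _))))
  where
  go : ∀ {g h : ℕ → ℚ} → (∀ j → g j ≡ h j) → ∀ N →
       sumℚ (applyUpTo g N) ≡ sumℚ (applyUpTo h N)
  go p zero    = refl
  go p (suc N) = cong₂ ℚ._+_ (p 0) (go (p ∘ suc) N)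

-- The series obtained from f by replacing each x_{i,j} by x_{i,j} ^ r.
infixl 8 _⟨x^_⟩

_⟨x^_⟩ : Series → (r : ℕ) → .{{NonZero r}} → Series
(f ⟨x^ r ⟩) .coeff m =
  indicator (All.all? (All.all? (r ∣?_)) m) ℚ.* coeff f (map (map (_/ r)) m)
(f ⟨x^ r ⟩) .coeff-cong m n m≈n = cong₂ ℚ._*_
  (indicator-cong (All.all? (All.all? (r ∣?_)) m) (All.all? (All.all? (r ∣?_)) n)
    (AllExponents-resp (divides 0 refl) m≈n)
    (AllExponents-resp (divides 0 refl) (λ i j → sym (m≈n i j))))
  (coeff-cong f _ _ λ i j → trans (exponent-map (_/ r) (0/n≡0 r) m i j)
    (trans (cong (_/ r) (m≈n i j)) (sym (exponent-map (_/ r) (0/n≡0 r) n i j))))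

fromℤ : ℤ → ℚ
fromℤ i = i ℚ./ 1

E⁺ : ℕ → Series
E⁺ d .coeff m = indicator (squareFree? m ×-dec (degree m ℕ.≟ d))
E⁺ d .coeff-cong m n m≈n = indicator-cong
  (squareFree? m ×-dec (degree m ℕ.≟ d)) (squareFree? n ×-dec (degree n ℕ.≟ d))
  (λ (sf , eq) → AllExponents-resp z≤n m≈n sf ,
                 trans (sym (degreeFrom-cong 1 m n m≈n)) eq)
  (λ (sf , eq) → AllExponents-resp z≤n (λ i j → sym (m≈n i j)) sf ,
                 trans (degreeFrom-cong 1 m n m≈n) eq)

-- ∑_{j ≥ 1} k x_{k,j} ^ e, where k = suc i.
weightedPowerSum : (i e : ℕ) → 0 < e → Series
weightedPowerSum i e 0<e =
  ∑∞ (λ j → fromℤ (+ suc i) • monomial (variablePower i j e)) width vanish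
  where
  vanish : ∀ m j → width m ≤ j →
           coeff (fromℤ (+ suc i) • monomial (variablePower i j e)) m ≡ 0ℚ
  vanish m j w with m ≈? variablePower i j e
  ... | no _  = ℚ.*-zeroʳ (fromℤ (+ suc i))
  ... | yes p = contradiction
    (trans (sym (exponent-width m i j w)) (trans (p i j) (exponent-variablePower i j e)))
    (ℕ.<⇒≢ 0<e)

-- The divisor k of d is suc (toℕ i).
P : ℕ → Series
P d = ∑ (filter (λ i → suc (toℕ i) ∣? d) (allFin d)) λ i →
  weightedPowerSum (toℕ i) (d / suc (toℕ i)) (m≥n⇒m/n>0 (toℕ<n i))

-- The list of α⁽¹⁾, α⁽²⁾, …, all further compositions being empty.
Polycomposition : Set
Polycomposition = List (List ℕ)

sizeFrom : ℕ → Polycomposition → ℕ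
sizeFrom r []      = 0
sizeFrom r (α ∷ δ) = r * sum α + sizeFrom (suc r) δ

IsPolycompositionOf : ℕ → Polycomposition → Set
IsPolycompositionOf n δ = All (All NonZero) δ × sizeFrom 1 δ ≡ n

ℓ : Polycomposition → ℕ
ℓ δ = sum (map length δ)

record Block : Set where
  constructor block
  field
    blockDegree  : ℕ
    multiplicity : ℕ
    .{{nonZero}} : NonZero multiplicity

blocksFrom : (r : ℕ) → .{{NonZero r}} → Polycomposition → List Block
blocksFrom r []      = []
blocksFrom r (α ∷ δ) = map (λ d → block d r) α ++ blocksFrom (suc r) δ

blocks : Polycomposition → List Block
blocks = blocksFrom 1

E⁺-block : Block → Series
E⁺-block (block d r) = E⁺ d ⟨x^ r ⟩

E⁺-poly : Polycomposition → Series
E⁺-poly δ = ∏ (map E⁺-block (blocks δ))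

-- The polycomposition δ = (d₁, …, d_k)^r with r = 2 ^ m.
record SingularDyadic : Set where
  constructor _^2^_
  field
    parts : List⁺ ℕ
    log₂r : ℕ

open SingularDyadic public

toPolycomposition : SingularDyadic → Polycomposition
toPolycomposition (c ^2^ m) = replicate (pred (2 ^ m)) [] ++ [ toList c ]

L : SingularDyadic → ℕ
L (c ^2^ m) = 2 ^ m * List⁺.last c

-- The compositions of suc a + n with first part at least suc a.
compositionsFrom : ℕ → ℕ → List (List⁺ ℕ)
compositionsFrom a zero    = [ suc a ∷ [] ]
compositionsFrom a (suc n) = map (suc a ∷⁺_) (compositionsFrom 0 n) ++ compositionsFrom (suc a) n

nonEmptyCompositions : ℕ → List (List⁺ ℕ)
nonEmptyCompositions zero    = []
nonEmptyCompositions (suc n) = compositionsFrom 0 n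

withExponent : ℕ → ℕ → List SingularDyadic
withExponent d m = map (_^2^ m) (nonEmptyCompositions ((d / 2 ^ m) {{ℕ.m^n≢0 2 m}}))

PCom*dyad : ℕ → List SingularDyadic
PCom*dyad d = concat (map (withExponent d) (filter (λ m → 2 ^ m ∣? d) (upTo d)))

IsComposition⁺ : ℕ → List⁺ ℕ → Set
IsComposition⁺ n c = All NonZero (toList c) × sum (toList c) ≡ n

sum-positive : ∀ x xs → NonZero x → ∃ λ k → sum (x ∷ xs) ≡ suc k
sum-positive (suc x) xs _ = x + sum xs , refl

∈-compositionsFrom⁻ : ∀ a n {c} → c ∈ compositionsFrom a n →
                      suc a ≤ List⁺.head c × IsComposition⁺ (suc a + n) c
∈-compositionsFrom⁻ a zero    (here refl) = ℕ.≤-refl , _ ∷ [] , refl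
∈-compositionsFrom⁻ a (suc n) p with ∈-++⁻ (map (suc a ∷⁺_) (compositionsFrom 0 n)) p
... | inj₁ q with ∈-map⁻ (suc a ∷⁺_) q
...   | c , r , refl with ∈-compositionsFrom⁻ 0 n r
...     | _ , nz , eq = ℕ.≤-refl , _ ∷ nz , cong (λ k → suc a + k) eq
∈-compositionsFrom⁻ a (suc n) p | inj₂ q with ∈-compositionsFrom⁻ (suc a) n q
... | a<h , nz , eq = ℕ.<⇒≤ a<h , nz , trans eq (sym (cong suc (ℕ.+-suc a n)))

∈-compositionsFrom⁺ : ∀ a n c → suc a ≤ List⁺.head c → IsComposition⁺ (suc a + n) c →
                      c ∈ compositionsFrom a n
∈-compositionsFrom⁺ a n (x ∷ xs) a<x (nz , eq) with ℕ.m≤n⇒m<n∨m≡n a<x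
∈-compositionsFrom⁺ a zero (x ∷ xs) a<x (nz , eq) | inj₁ a<<x =
  contradiction (ℕ.≤-trans (ℕ.m≤m+n x (sum xs)) (ℕ.≤-reflexive (trans eq (ℕ.+-identityʳ (suc a)))))
                (ℕ.<⇒≱ a<<x)
∈-compositionsFrom⁺ a (suc n) (x ∷ xs) a<x (nz , eq) | inj₁ a<<x =
  ∈-++⁺ʳ (map (suc a ∷⁺_) (compositionsFrom 0 n))
    (∈-compositionsFrom⁺ (suc a) n (x ∷ xs) a<<x (nz , trans eq (cong suc (ℕ.+-suc a n))))
∈-compositionsFrom⁺ a zero (x ∷ []) a<x (nz , eq) | inj₂ refl = here refl
∈-compositionsFrom⁺ a zero (x ∷ y ∷ ys) a<x (_ ∷ nz ∷ _ , eq) | inj₂ refl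
  with sum-positive y ys nz
... | k , eq′ with trans (sym eq′) (ℕ.+-cancelˡ-≡ (suc a) _ _ eq)
...   | ()
∈-compositionsFrom⁺ a (suc n) (x ∷ []) a<x (nz , eq) | inj₂ refl
  with ℕ.+-cancelˡ-≡ (suc a) 0 (suc n) eq
... | ()
∈-compositionsFrom⁺ a (suc n) (x ∷ y ∷ ys) a<x (_ ∷ nz , eq) | inj₂ refl =
  ∈-++⁺ˡ (∈-map⁺ (suc a ∷⁺_) (∈-compositionsFrom⁺ 0 n (y ∷ ys)
    (ℕ.>-nonZero⁻¹ y {{All.head nz}}) (nz , ℕ.+-cancelˡ-≡ (suc a) _ _ eq)))

compositionsFrom-unique : ∀ a n → Unique (compositionsFrom a n)
compositionsFrom-unique a zero    = [] ∷ []
compositionsFrom-unique a (suc n) = Unique.++⁺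
  (Unique.map⁺ (λ { refl → refl }) (compositionsFrom-unique 0 n))
  (compositionsFrom-unique (suc a) n)
  λ (p , q) → disjoint p q
  where
  disjoint : ∀ {c} → c ∈ map (suc a ∷⁺_) (compositionsFrom 0 n) →
             ¬ c ∈ compositionsFrom (suc a) n
  disjoint p q with ∈-map⁻ (suc a ∷⁺_) p
  ... | _ , _ , refl = ℕ.<-irrefl refl (proj₁ (∈-compositionsFrom⁻ (suc a) n q))

∈-nonEmptyCompositions : ∀ n c → c ∈ nonEmptyCompositions n ⇔ IsComposition⁺ n c
∈-nonEmptyCompositions zero    (x ∷ xs) = mk⇔ (λ ()) λ { (nz ∷ _ , eq) →
  contradiction (trans (sym eq) (proj₂ (sum-positive x xs nz))) λ () }
∈-nonEmptyCompositions (suc n) c        = mk⇔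
  (λ p → proj₂ (∈-compositionsFrom⁻ 0 n p))
  (λ { (nz , eq) → ∈-compositionsFrom⁺ 0 n c (ℕ.>-nonZero⁻¹ _ {{All.head nz}}) (nz , eq) })

nonEmptyCompositions-unique : ∀ n → Unique (nonEmptyCompositions n)
nonEmptyCompositions-unique zero    = []
nonEmptyCompositions-unique (suc n) = compositionsFrom-unique 0 n

sizeFrom-singular : ∀ r k α → sizeFrom r (replicate k [] ++ [ α ]) ≡ (k + r) * sum α
sizeFrom-singular r zero    α = ℕ.+-identityʳ (r * sum α)
sizeFrom-singular r (suc k) α = trans (cong (_+ sizeFrom (suc r) (replicate k [] ++ [ α ])) (ℕ.*-zeroʳ r))
  (trans (sizeFrom-singular (suc r) k α) (cong (_* sum α) (ℕ.+-suc k r)))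

size-toPolycomposition : ∀ c m → sizeFrom 1 (toPolycomposition (c ^2^ m)) ≡ 2 ^ m * sum (toList c)
size-toPolycomposition c m = trans (sizeFrom-singular 1 (pred (2 ^ m)) (toList c))
  (cong (_* sum (toList c)) (trans (ℕ.+-comm (pred (2 ^ m)) 1)
                                   (ℕ.suc-pred (2 ^ m) {{ℕ.m^n≢0 2 m}})))

n<2^n : ∀ n → n < 2 ^ n
n<2^n zero    = s≤s z≤n
n<2^n (suc n) = ℕ.≤-trans (s≤s (n<2^n n))
  (ℕ.+-mono-≤ (ℕ.m^n>0 2 n) (ℕ.m≤m+n (2 ^ n) 0))

∈-PCom*dyad : ∀ d δ → δ ∈ PCom*dyad d ⇔ IsPolycompositionOf d (toPolycomposition δ)
∈-PCom*dyad d δ@(c ^2^ m) = mk⇔ to from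
  where
  open Equivalence using () renaming (to to ⇒; from to ⇐)
  instance 2^m≢0 = ℕ.m^n≢0 2 m

  to : δ ∈ PCom*dyad d → IsPolycompositionOf d (toPolycomposition δ)
  to p with ∈-concat⁻′ _ p
  ... | _ , q , r with ∈-map⁻ (withExponent d) r
  ...   | m , s , refl with ∈-map⁻ (_^2^ m) q
  ...     | c , t , refl with ∈-filter⁻ (λ m → 2 ^ m ∣? d) {xs = upTo d} s
  ...       | _ , 2^m∣d with ⇒ (∈-nonEmptyCompositions (d / 2 ^ m) c) t
  ...         | nz , eq =
    All.++⁺ (All.replicate⁺ (pred (2 ^ m)) []) (nz ∷ []) ,
    trans (size-toPolycomposition c m)
      (trans (cong (2 ^ m *_) eq) (trans (ℕ.*-comm (2 ^ m) _) (m/n*n≡m 2^m∣d)))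

  from : IsPolycompositionOf d (toPolycomposition δ) → δ ∈ PCom*dyad d
  from (nzs , eq) = ∈-concat⁺′
    (∈-map⁺ (_^2^ m) (⇐ (∈-nonEmptyCompositions (d / 2 ^ m) c)
      (nz , sym (trans (cong (_/ 2 ^ m) d≡) (m*n/n≡m (sum (toList c)) (2 ^ m))))))
    (∈-map⁺ (withExponent d) (∈-filter⁺ (λ m → 2 ^ m ∣? d) (∈-upTo⁺ m<d) (divides (sum (toList c)) d≡)))
    where
    nz : All NonZero (toList c)
    nz = All.head (All.++⁻ʳ (replicate (pred (2 ^ m)) []) nzs)

    d≡ : d ≡ sum (toList c) * 2 ^ m
    d≡ = trans (sym eq) (trans (size-toPolycomposition c m) (ℕ.*-comm (2 ^ m) _))

    m<d : m < d
    m<d with sum-positive (List⁺.head c) (List⁺.tail c) (All.head nz)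
    ... | k , eq′ = ℕ.<-≤-trans (n<2^n m) (ℕ.≤-trans (ℕ.m≤m+n (2 ^ m) (k * 2 ^ m))
      (ℕ.≤-reflexive (sym (trans d≡ (cong (_* 2 ^ m) eq′)))))

PCom*dyad-unique : ∀ d → Unique (PCom*dyad d)
PCom*dyad-unique d = Unique.concat⁺
  (All.map⁺ (All.universal (λ m → Unique.map⁺ (λ { refl → refl })
    (nonEmptyCompositions-unique ((d / 2 ^ m) {{ℕ.m^n≢0 2 m}}))) _))
  (AllPairs.map⁺ (AllPairs.map (λ {m} {n} → disjoint {m} {n}) (Unique.filter⁺ (λ m → 2 ^ m ∣? d) (Unique.upTo⁺ d))))
  where
  disjoint : ∀ {m n} → m ≢ n → ∀ {δ} → ¬ (δ ∈ withExponent d m × δ ∈ withExponent d n)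
  disjoint m≢n (p , q) with ∈-map⁻ (_^2^ _) p | ∈-map⁻ (_^2^ _) q
  ... | _ , _ , refl | _ , _ , refl = m≢n refl

{-# OPTIONS --safe #-}

-- Let E = ∏ (1 + x_{i,j} tⁱ) = 1 + ∑ E⁺_d t^d.  Expanding t E′ / E in powers of the E⁺_d gives
-- Q_d = ∑ (-1)^(k-1) d_k E⁺_{d₁} ⋯ E⁺_{d_k} over the compositions of d, while the product formula
-- gives Q_d = ∑ (-1)^(d/k-1) k x_{k,j}^{d/k}.  Signs are removed by r Q(x^r) = H_r - H_{2r}, where
-- H_r is the sum of all r k x_{k,j}^e with r ∣ e, so the sum over r = 2^m telescopes to H_1 = P.
-- Everything is computed at a fixed monomial: there E⁺(x^r) is a product over the entries of the
-- exponent table and Q a derivation, so t E′ = E Q reduces to its case of one variable.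

module Submission where

open import Defs
open import Data.Nat using (ℕ; _≤_; _∸_)
open import Data.Integer using (+_; -1ℤ) renaming (_*_ to _*ℤ_; _^_ to _^ℤ_)

import Algebra.Properties.CommutativeSemigroup as CommutativeSemigroup
open import Data.Fin.Base using (toℕ)
open import Data.Fin.Properties using (toℕ<n)
open import Data.Integer.Base as ℤ using (ℤ)
import Data.Integer.Properties as ℤ
open import Data.List.Base hiding (sum)
open import Data.List.NonEmpty as List⁺ using (List⁺; _∷_; _∷⁺_; toList)
open import Data.List.Properties using (map-upTo; map-tabulate; map-∘; ++-identityʳ)
open import Data.List.Relation.Unary.All as All using (All; []; _∷_)
import Data.List.Relation.Unary.All.Properties as All
open import Data.Nat.Base as ℕ using (zero; suc; pred; _<_; _^_; z≤n; s≤s; NonZero)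
open import Data.Nat.Divisibility
open import Data.Nat.DivMod using (_/_; m/n*n≡m; m*n/n≡m; m≥n⇒m/n>0; 0/n≡0; n/n≡1)
open import Data.Nat.ListAction using (sum)
import Data.Nat.Properties as ℕ
open import Data.Product.Base using (_×_; _,_; proj₁; proj₂; ∃)
open import Data.Rational.Base as ℚ using (ℚ; 0ℚ; 1ℚ)
import Data.Rational.Properties as ℚ
open import Data.Rational.Solver using (module +-*-Solver)
import Data.Rational.Unnormalised.Base as ℚᵘ
import Data.Rational.Unnormalised.Properties as ℚᵘ
open import Data.Sum.Base using (_⊎_; inj₁; inj₂)
open import Function.Base using (_∘_; id)
open import Relation.Binary.Definitions using (Tri; tri<; tri≈; tri>)
open import Relation.Binary.PropositionalEquality hiding ([_])
open import Relation.Nullary using (¬_; Dec; yes; no; contradiction)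
open import Relation.Nullary.Decidable using (_×-dec_; _⊎-dec_)

open CommutativeSemigroup ℕ.+-commutativeSemigroup using (interchange)
open CommutativeSemigroup ℕ.*-commutativeSemigroup using (x∙yz≈y∙xz)
open ≡-Reasoning
open +-*-Solver using (solve; con; _:=_; _:+_; _:*_; :-_; _:-_)

private variable
  A B : Set

-- The expansion of t E′ / E is carried out as a recursion on the first part of a composition.
-- Prepending a part d to a non-empty composition multiplies on the left by E⁺_d, flips the sign and
-- keeps the last part, so the weight L is untouched. Suppose the compositions of each j ≤ n sum to
-- Q_j. Those of d = a + 1 + n with first part at least a + 1 then sum to d E⁺_d - ∑ E⁺_(d-j) Q_j
-- over 1 ≤ j ≤ n, and since d E⁺_d is the same sum over 1 ≤ j ≤ d, only the tail j > n is left.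
-- This tail is the quantity carried through the induction; for a = 0 it shrinks to Q_d. All of this
-- is done for x^r with arbitrary r ≥ 1; powers of 2 enter with the telescoping, which ends because
-- 2^d > d. A monomial is a list of rows of exponents, and a factorisation splits every entry
-- independently. Hence the facts on units, derivations, weights and supports are proved once for
-- lists with entries of any type and applied twice: to the exponents in a row with all weights 1,
-- and to the rows with weight i in row i.

fromℕ : ℕ → ℚ
fromℕ n = fromℤ (+ n)

-- `fromℤ` divides out a gcd and is stuck on a variable, so the homomorphism laws are checked on
-- unnormalised fractions with denominator 1.
toℚᵘ-fromℤ : ∀ i → ℚ.toℚᵘ (fromℤ i) ℚᵘ.≃ ℚᵘ.mkℚᵘ i 0
toℚᵘ-fromℤ i = ℚ.toℚᵘ-fromℚᵘ (ℚᵘ.mkℚᵘ i 0)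

fromℤ-+ : ∀ i j → fromℤ (i ℤ.+ j) ≡ fromℤ i ℚ.+ fromℤ j
fromℤ-+ i j = ℚ.toℚᵘ-injective (ℚᵘ.≃-trans (toℚᵘ-fromℤ (i ℤ.+ j)) (ℚᵘ.≃-sym
  (ℚᵘ.≃-trans (ℚ.toℚᵘ-homo-+ (fromℤ i) (fromℤ j))
  (ℚᵘ.≃-trans (ℚᵘ.+-cong (toℚᵘ-fromℤ i) (toℚᵘ-fromℤ j))
    (ℚᵘ.*≡* (cong (ℤ._* (+ 1)) (cong₂ ℤ._+_ (ℤ.*-identityʳ i) (ℤ.*-identityʳ j))))))))

fromℤ-* : ∀ i j → fromℤ (i ℤ.* j) ≡ fromℤ i ℚ.* fromℤ j
fromℤ-* i j = ℚ.toℚᵘ-injective (ℚᵘ.≃-trans (toℚᵘ-fromℤ (i ℤ.* j)) (ℚᵘ.≃-sym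
  (ℚᵘ.≃-trans (ℚ.toℚᵘ-homo-* (fromℤ i) (fromℤ j))
    (ℚᵘ.*-cong (toℚᵘ-fromℤ i) (toℚᵘ-fromℤ j)))))

fromℕ-+ : ∀ m n → fromℕ (m ℕ.+ n) ≡ fromℕ m ℚ.+ fromℕ n
fromℕ-+ m n = trans (cong fromℤ (ℤ.pos-+ m n)) (fromℤ-+ (+ m) (+ n))

fromℕ-* : ∀ m n → fromℕ (m ℕ.* n) ≡ fromℕ m ℚ.* fromℕ n
fromℕ-* m n = trans (cong fromℤ (ℤ.pos-* m n)) (fromℤ-* (+ m) (+ n))

-- Finite sums of rationals.

∑ℚ : List A → (A → ℚ) → ℚ
∑ℚ xs f = sumℚ (map f xs)

∑ℚ-congᴬ : ∀ {f g : A → ℚ} {xs} → All (λ x → f x ≡ g x) xs → ∑ℚ xs f ≡ ∑ℚ xs g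
∑ℚ-congᴬ []       = refl
∑ℚ-congᴬ (p ∷ ps) = cong₂ ℚ._+_ p (∑ℚ-congᴬ ps)

∑ℚ-cong : ∀ {f g : A → ℚ} xs → (∀ x → f x ≡ g x) → ∑ℚ xs f ≡ ∑ℚ xs g
∑ℚ-cong xs f≡g = ∑ℚ-congᴬ (All.universal f≡g xs)

∑ℚ-++ : ∀ (f : A → ℚ) xs ys → ∑ℚ (xs ++ ys) f ≡ ∑ℚ xs f ℚ.+ ∑ℚ ys f
∑ℚ-++ f []       ys = sym (ℚ.+-identityˡ _)
∑ℚ-++ f (x ∷ xs) ys = trans (cong (f x ℚ.+_) (∑ℚ-++ f xs ys)) (sym (ℚ.+-assoc (f x) _ _))

∑ℚ-map : ∀ (f : B → ℚ) (g : A → B) xs → ∑ℚ (map g xs) f ≡ ∑ℚ xs (f ∘ g)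
∑ℚ-map f g []       = refl
∑ℚ-map f g (x ∷ xs) = cong (f (g x) ℚ.+_) (∑ℚ-map f g xs)

∑ℚ-zero : ∀ (xs : List A) → ∑ℚ xs (λ _ → 0ℚ) ≡ 0ℚ
∑ℚ-zero []       = refl
∑ℚ-zero (x ∷ xs) = trans (ℚ.+-identityˡ _) (∑ℚ-zero xs)

∑ℚ-+ : ∀ (f g : A → ℚ) xs → ∑ℚ xs (λ x → f x ℚ.+ g x) ≡ ∑ℚ xs f ℚ.+ ∑ℚ xs g
∑ℚ-+ f g []       = refl
∑ℚ-+ f g (x ∷ xs) = trans (cong ((f x ℚ.+ g x) ℚ.+_) (∑ℚ-+ f g xs))
  (solve 4 (λ a b c d → (a :+ b) :+ (c :+ d) := (a :+ c) :+ (b :+ d)) refl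
    (f x) (g x) (∑ℚ xs f) (∑ℚ xs g))

∑ℚ-*ˡ : ∀ c (f : A → ℚ) xs → ∑ℚ xs (λ x → c ℚ.* f x) ≡ c ℚ.* ∑ℚ xs f
∑ℚ-*ˡ c f []       = sym (ℚ.*-zeroʳ c)
∑ℚ-*ˡ c f (x ∷ xs) = trans (cong (c ℚ.* f x ℚ.+_) (∑ℚ-*ˡ c f xs)) (sym (ℚ.*-distribˡ-+ c (f x) _))

∑ℚ-*ʳ : ∀ c (f : A → ℚ) xs → ∑ℚ xs (λ x → f x ℚ.* c) ≡ ∑ℚ xs f ℚ.* c
∑ℚ-*ʳ c f xs = trans (∑ℚ-cong xs (λ x → ℚ.*-comm (f x) c))
  (trans (∑ℚ-*ˡ c f xs) (ℚ.*-comm c _))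

∑ℚ-swap : ∀ (f : A → B → ℚ) xs ys →
          ∑ℚ xs (λ x → ∑ℚ ys (f x)) ≡ ∑ℚ ys (λ y → ∑ℚ xs (λ x → f x y))
∑ℚ-swap f []       ys = sym (∑ℚ-zero ys)
∑ℚ-swap f (x ∷ xs) ys = trans (cong (∑ℚ ys (f x) ℚ.+_) (∑ℚ-swap f xs ys))
  (sym (∑ℚ-+ (f x) (λ y → ∑ℚ xs (λ x → f x y)) ys))

∑ℚ-separate : ∀ (f : A → ℚ) (g : B → ℚ) xs ys →
              ∑ℚ xs (λ x → ∑ℚ ys (λ y → f x ℚ.* g y)) ≡ ∑ℚ xs f ℚ.* ∑ℚ ys g
∑ℚ-separate f g xs ys = trans (∑ℚ-cong xs (λ x → ∑ℚ-*ˡ (f x) g ys)) (∑ℚ-*ʳ _ f xs)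

∑ℚ-concat : ∀ (f : A → ℚ) xss → ∑ℚ (concat xss) f ≡ ∑ℚ xss (λ xs → ∑ℚ xs f)
∑ℚ-concat f []         = refl
∑ℚ-concat f (xs ∷ xss) = trans (∑ℚ-++ f xs (concat xss)) (cong (∑ℚ xs f ℚ.+_) (∑ℚ-concat f xss))

∑ℚ-filter : ∀ {Q : A → Set} (Q? : ∀ x → Dec (Q x)) (f : A → ℚ) xs →
            ∑ℚ (filter Q? xs) f ≡ ∑ℚ xs (λ x → indicator (Q? x) ℚ.* f x)
∑ℚ-filter Q? f []       = refl
∑ℚ-filter Q? f (x ∷ xs) with Q? x
... | yes _ = cong₂ ℚ._+_ (sym (ℚ.*-identityˡ (f x))) (∑ℚ-filter Q? f xs)
... | no _  = trans (∑ℚ-filter Q? f xs)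
  (trans (sym (ℚ.+-identityˡ _)) (cong (ℚ._+ _) (sym (ℚ.*-zeroˡ (f x)))))

∑ℚ-splitList : ∀ (s : A → List (A × A)) (h : List A × List A → ℚ) x xs →
  ∑ℚ (splitList s (x ∷ xs)) h ≡
  ∑ℚ (s x) (λ p → ∑ℚ (splitList s xs) (λ q → h (consBoth p q)))
∑ℚ-splitList s h x xs = go (s x)
  where
  go : ∀ ps → ∑ℚ (cartesianProductWith consBoth ps (splitList s xs)) h ≡
              ∑ℚ ps (λ p → ∑ℚ (splitList s xs) (λ q → h (consBoth p q)))
  go []       = refl
  go (p ∷ ps) = trans (∑ℚ-++ h (map (consBoth p) (splitList s xs)) _)
    (cong₂ ℚ._+_ (∑ℚ-map h (consBoth p) (splitList s xs)) (go ps))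

-- Convolution, units and derivations on lists.

-- For `s = factorisations` this is the coefficient of a product of series, to which `coeff (f · g)`
-- unfolds.
convolve : (A → List (A × A)) → (A → ℚ) → (A → ℚ) → A → ℚ
convolve s f g x = ∑ℚ (s x) (λ (a , b) → f a ℚ.* g b)

Counit : (A → List (A × A)) → (A → ℚ) → Set
Counit s ε = (∀ h x → convolve s ε h x ≡ h x) × (∀ h x → convolve s h ε x ≡ h x)

productℚ : (A → ℚ) → List A → ℚ
productℚ f = foldr (λ x p → f x ℚ.* p) 1ℚ

-- The extension of f to lists as a derivation relative to ε: the only terms that
-- survive take f at one position and ε at all others.
derive : (ℕ → ℕ) → (ε f : A → ℚ) → ℕ → List A → ℚ
derive c ε f i []       = 0ℚ
derive c ε f i (x ∷ xs) =
  fromℕ (c i) ℚ.* f x ℚ.* productℚ ε xs ℚ.+ ε x ℚ.* derive c ε f (suc i) xs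

-- Common form of the sum of a row (`c` constantly 1, `w = id`) and of the degree of a table
-- (`c = id`, `w = sum`).
weightedSum : (ℕ → ℕ) → (A → ℕ) → ℕ → List A → ℕ
weightedSum c w i []       = 0
weightedSum c w i (x ∷ xs) = c i ℕ.* w x ℕ.+ weightedSum c w (suc i) xs

-- Entries are split independently, so the tail can be absorbed with the head held fixed, and then
-- the head.
splitList-counit : ∀ {s : A → List (A × A)} {ε} → Counit s ε →
                   Counit (splitList s) (productℚ ε)
splitList-counit {s = s} {ε} (unitˡ , unitʳ) = left , right
  where
  left : ∀ h xs → convolve (splitList s) (productℚ ε) h xs ≡ h xs
  left h []       = trans (ℚ.+-identityʳ _) (ℚ.*-identityˡ _)
  left h (x ∷ xs) = begin
    convolve (splitList s) (productℚ ε) h (x ∷ xs)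
      ≡⟨ ∑ℚ-splitList s _ x xs ⟩
    ∑ℚ (s x) (λ (a , b) → ∑ℚ (splitList s xs) λ (as , bs) →
      (ε a ℚ.* productℚ ε as) ℚ.* h (b ∷ bs))
      ≡⟨ ∑ℚ-cong (s x) (λ (a , b) → trans
           (∑ℚ-cong (splitList s xs) (λ (as , bs) → ℚ.*-assoc (ε a) _ _))
           (trans (∑ℚ-*ˡ (ε a) _ (splitList s xs))
                  (cong (ε a ℚ.*_) (left (λ bs → h (b ∷ bs)) xs)))) ⟩
    convolve s ε (λ b → h (b ∷ xs)) x
      ≡⟨ unitˡ (λ b → h (b ∷ xs)) x ⟩
    h (x ∷ xs) ∎

  right : ∀ h xs → convolve (splitList s) h (productℚ ε) xs ≡ h xs
  right h []       = trans (ℚ.+-identityʳ _) (ℚ.*-identityʳ _)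
  right h (x ∷ xs) = begin
    convolve (splitList s) h (productℚ ε) (x ∷ xs)
      ≡⟨ ∑ℚ-splitList s _ x xs ⟩
    ∑ℚ (s x) (λ (a , b) → ∑ℚ (splitList s xs) λ (as , bs) →
      h (a ∷ as) ℚ.* (ε b ℚ.* productℚ ε bs))
      ≡⟨ ∑ℚ-cong (s x) (λ (a , b) → trans
           (∑ℚ-cong (splitList s xs) (λ (as , bs) →
             solve 3 (λ p q r → p :* (q :* r) := (p :* r) :* q) refl (h (a ∷ as)) (ε b) (productℚ ε bs)))
           (trans (∑ℚ-*ʳ (ε b) _ (splitList s xs))
                  (cong (ℚ._* ε b) (right (λ as → h (a ∷ as)) xs)))) ⟩
    convolve s (λ a → h (a ∷ xs)) ε x
      ≡⟨ unitʳ (λ a → h (a ∷ xs)) x ⟩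
    h (x ∷ xs) ∎

-- The Leibniz rule for a product: the hypothesis makes `δ` the logarithmic derivative of `σ` at one
-- position. In the term of `derive` belonging to that position, the factors `ε` at all other
-- positions act as units on `σ`, so each position multiplies the whole product by its own weight
-- and the weights add up.
splitList-derive : ∀ {s : A → List (A × A)} {ε σ δ : A → ℚ} {w : A → ℕ} c → Counit s ε →
  (∀ x → convolve s σ δ x ≡ fromℕ (w x) ℚ.* σ x) →
  ∀ i xs → convolve (splitList s) (productℚ σ) (derive c ε δ i) xs ≡
           fromℕ (weightedSum c w i xs) ℚ.* productℚ σ xs
splitList-derive c unit leibniz i [] = refl
splitList-derive {s = s} {ε} {σ} {δ} {w} c unit leibniz i (x ∷ xs) = begin
  convolve (splitList s) Σ (derive c ε δ i) (x ∷ xs)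
    ≡⟨ ∑ℚ-splitList s _ x xs ⟩
  ∑ℚ (s x) (λ (a , b) → ∑ℚ (splitList s xs) λ (as , bs) →
    (σ a ℚ.* Σ as) ℚ.* (k ℚ.* δ b ℚ.* Ε bs ℚ.+ ε b ℚ.* Δ bs))
    ≡⟨ ∑ℚ-cong (s x) (λ (a , b) → trans
         (∑ℚ-cong (splitList s xs) (λ (as , bs) → expand (σ a) (Σ as) k (δ b) (Ε bs) (ε b) (Δ bs)))
         (∑ℚ-+ (λ (as , bs) → (k ℚ.* (σ a ℚ.* δ b)) ℚ.* (Σ as ℚ.* Ε bs)) (λ (as , bs) → (σ a ℚ.* ε b) ℚ.* (Σ as ℚ.* Δ bs)) (splitList s xs))) ⟩
  ∑ℚ (s x) (λ (a , b) →
    ∑ℚ (splitList s xs) (λ (as , bs) → (k ℚ.* (σ a ℚ.* δ b)) ℚ.* (Σ as ℚ.* Ε bs)) ℚ.+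
    ∑ℚ (splitList s xs) (λ (as , bs) → (σ a ℚ.* ε b) ℚ.* (Σ as ℚ.* Δ bs)))
    ≡⟨ ∑ℚ-+ (λ (a , b) → ∑ℚ (splitList s xs) (λ (as , bs) → (k ℚ.* (σ a ℚ.* δ b)) ℚ.* (Σ as ℚ.* Ε bs))) (λ (a , b) → ∑ℚ (splitList s xs) (λ (as , bs) → (σ a ℚ.* ε b) ℚ.* (Σ as ℚ.* Δ bs))) (s x) ⟩
  ∑ℚ (s x) (λ (a , b) →
    ∑ℚ (splitList s xs) (λ (as , bs) → (k ℚ.* (σ a ℚ.* δ b)) ℚ.* (Σ as ℚ.* Ε bs))) ℚ.+
  ∑ℚ (s x) (λ (a , b) →
    ∑ℚ (splitList s xs) (λ (as , bs) → (σ a ℚ.* ε b) ℚ.* (Σ as ℚ.* Δ bs)))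
    ≡⟨ cong₂ ℚ._+_ (∑ℚ-separate (λ (a , b) → k ℚ.* (σ a ℚ.* δ b)) (λ (as , bs) → Σ as ℚ.* Ε bs) (s x) (splitList s xs))
                   (∑ℚ-separate (λ (a , b) → σ a ℚ.* ε b) (λ (as , bs) → Σ as ℚ.* Δ bs) (s x) (splitList s xs)) ⟩
  ∑ℚ (s x) (λ (a , b) → k ℚ.* (σ a ℚ.* δ b)) ℚ.* convolve (splitList s) Σ Ε xs ℚ.+
  convolve s σ ε x ℚ.* convolve (splitList s) Σ Δ xs
    ≡⟨ cong₂ ℚ._+_
         (cong₂ ℚ._*_ (trans (∑ℚ-*ˡ k (λ (a , b) → σ a ℚ.* δ b) (s x)) (cong (k ℚ.*_) (leibniz x)))
                      (proj₂ (splitList-counit unit) Σ xs))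
         (cong₂ ℚ._*_ (proj₂ unit σ x) (splitList-derive c unit leibniz (suc i) xs)) ⟩
  (k ℚ.* (fromℕ (w x) ℚ.* σ x)) ℚ.* Σ xs ℚ.+ σ x ℚ.* (fromℕ W ℚ.* Σ xs)
    ≡⟨ collect k (fromℕ (w x)) (σ x) (Σ xs) (fromℕ W) ⟩
  (k ℚ.* fromℕ (w x) ℚ.+ fromℕ W) ℚ.* (σ x ℚ.* Σ xs)
    ≡⟨ cong (λ n → n ℚ.* (σ x ℚ.* Σ xs)) (sym (trans (fromℕ-+ (c i ℕ.* w x) W)
         (cong (ℚ._+ fromℕ W) (fromℕ-* (c i) (w x))))) ⟩
  fromℕ (c i ℕ.* w x ℕ.+ W) ℚ.* (σ x ℚ.* Σ xs) ∎
  where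
  k = fromℕ (c i)
  W = weightedSum c w (suc i) xs
  Σ = productℚ σ
  Ε = productℚ ε
  Δ = derive c ε δ (suc i)

  expand : ∀ a A k d E e D → (a ℚ.* A) ℚ.* (k ℚ.* d ℚ.* E ℚ.+ e ℚ.* D) ≡
           (k ℚ.* (a ℚ.* d)) ℚ.* (A ℚ.* E) ℚ.+ (a ℚ.* e) ℚ.* (A ℚ.* D)
  expand = solve 7 (λ a A k d E e D → (a :* A) :* (k :* d :* E :+ e :* D) :=
    (k :* (a :* d)) :* (A :* E) :+ (a :* e) :* (A :* D)) refl

  collect : ∀ k v s S W → (k ℚ.* (v ℚ.* s)) ℚ.* S ℚ.+ s ℚ.* (W ℚ.* S) ≡
            (k ℚ.* v ℚ.+ W) ℚ.* (s ℚ.* S)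
  collect = solve 5 (λ k v s S W → (k :* (v :* s)) :* S :+ s :* (W :* S) :=
    (k :* v :+ W) :* (s :* S)) refl

splitList-weightedSum : ∀ {s : A → List (A × A)} {w : A → ℕ} c →
  (∀ x → All (λ (a , b) → w a ℕ.+ w b ≡ w x) (s x)) →
  ∀ i xs → All (λ (as , bs) → weightedSum c w i as ℕ.+ weightedSum c w i bs ≡ weightedSum c w i xs)
               (splitList s xs)
splitList-weightedSum c additive i []       = refl ∷ []
splitList-weightedSum {s = s} {w} c additive i (x ∷ xs) =
  All.cartesianProductWith⁺ (setoid _) (setoid _) consBoth (s x) (splitList s xs) λ p∈ q∈ →
    split (All.lookup (additive x) p∈)
          (All.lookup (splitList-weightedSum c additive (suc i) xs) q∈)
  where
  split : ∀ {a b A B W} → a ℕ.+ b ≡ w x → A ℕ.+ B ≡ W →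
          (c i ℕ.* a ℕ.+ A) ℕ.+ (c i ℕ.* b ℕ.+ B) ≡ c i ℕ.* w x ℕ.+ W
  split {a} {b} {A} {B} p q = trans (interchange (c i ℕ.* a) A (c i ℕ.* b) B)
    (cong₂ ℕ._+_ (trans (sym (ℕ.*-distribˡ-+ (c i) a b)) (cong (c i ℕ.*_) p)) q)

derive-minus : ∀ c (ε f g : A → ℚ) i xs →
  derive c ε (λ x → f x ℚ.- g x) i xs ≡ derive c ε f i xs ℚ.- derive c ε g i xs
derive-minus c ε f g i []       = refl
derive-minus c ε f g i (x ∷ xs) = trans
  (cong (λ d → fromℕ (c i) ℚ.* (f x ℚ.- g x) ℚ.* productℚ ε xs ℚ.+ ε x ℚ.* d)
        (derive-minus c ε f g (suc i) xs))
  (solve 7 (λ k f g E e F G → k :* (f :- g) :* E :+ e :* (F :- G) :=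
      (k :* f :* E :+ e :* F) :- (k :* g :* E :+ e :* G)) refl
    (fromℕ (c i)) (f x) (g x) (productℚ ε xs) (ε x)
    (derive c ε f (suc i) xs) (derive c ε g (suc i) xs))

derive-cong : ∀ c (ε : A → ℚ) {f g : A → ℚ} → (∀ x → f x ≡ g x) → ∀ i xs →
  derive c ε f i xs ≡ derive c ε g i xs
derive-cong c ε f≡g i []       = refl
derive-cong c ε f≡g i (x ∷ xs) = cong₂ ℚ._+_
  (cong (λ d → fromℕ (c i) ℚ.* d ℚ.* productℚ ε xs) (f≡g x))
  (cong (ε x ℚ.*_) (derive-cong c ε f≡g (suc i) xs))

-- Supports of products and derivations.

productℚ-support : ∀ c {ε : A → ℚ} {w : A → ℕ} → (∀ x → ε x ≡ 0ℚ ⊎ w x ≡ 0) →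
  ∀ i xs → productℚ ε xs ≡ 0ℚ ⊎ weightedSum c w i xs ≡ 0
productℚ-support c sup i []       = inj₂ refl
productℚ-support c {ε} sup i (x ∷ xs) with sup x | productℚ-support c sup (suc i) xs
... | inj₁ p | _      = inj₁ (trans (cong (ℚ._* productℚ ε xs) p) (ℚ.*-zeroˡ (productℚ ε xs)))
... | inj₂ _ | inj₁ q = inj₁ (trans (cong (ε x ℚ.*_) q) (ℚ.*-zeroʳ (ε x)))
... | inj₂ p | inj₂ q = inj₂ (cong₂ ℕ._+_ (trans (cong (c i ℕ.*_) p) (ℕ.*-zeroʳ (c i))) q)

PositiveMultiple : ℕ → ℕ → Set
PositiveMultiple r n = r ∣ n × 0 < n

-- A term with `δ` at one position survives only if all other entries have weight 0. The total
-- weight is then `c i` times the weight of that entry, a multiple of `r`, and positive because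
-- indices start above 0.
derive-support : ∀ r c {ε δ : A → ℚ} {w : A → ℕ} → (∀ i → 0 < i → 0 < c i) →
  (∀ x → ε x ≡ 0ℚ ⊎ w x ≡ 0) →
  (∀ x → δ x ≡ 0ℚ ⊎ PositiveMultiple r (w x)) →
  ∀ i → 0 < i → ∀ xs →
  derive c ε δ i xs ≡ 0ℚ ⊎ PositiveMultiple r (weightedSum c w i xs)
derive-support r c c>0 supε supδ i i>0 []       = inj₁ refl
derive-support r c {ε} {δ} {w} c>0 supε supδ i i>0 (x ∷ xs) = combine first second
  where
  E = productℚ ε xs
  D = derive c ε δ (suc i) xs
  W = weightedSum c w (suc i) xs

  first : fromℕ (c i) ℚ.* δ x ℚ.* E ≡ 0ℚ ⊎ PositiveMultiple r (c i ℕ.* w x ℕ.+ W)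
  first with supδ x | productℚ-support c supε (suc i) xs
  ... | inj₁ p | _ = inj₁ (trans (cong (λ d → fromℕ (c i) ℚ.* d ℚ.* E) p)
    (trans (cong (ℚ._* E) (ℚ.*-zeroʳ (fromℕ (c i)))) (ℚ.*-zeroˡ E)))
  ... | inj₂ _ | inj₁ q = inj₁ (trans (cong (fromℕ (c i) ℚ.* δ x ℚ.*_) q) (ℚ.*-zeroʳ (fromℕ (c i) ℚ.* δ x)))
  ... | inj₂ (r∣ , pos) | inj₂ q = inj₂ (subst (PositiveMultiple r)
    (trans (sym (ℕ.+-identityʳ (c i ℕ.* w x))) (cong (c i ℕ.* w x ℕ.+_) (sym q)))
    (∣n⇒∣m*n (c i) r∣ , ℕ.*-mono-≤ (c>0 i i>0) pos))

  second : ε x ℚ.* D ≡ 0ℚ ⊎ PositiveMultiple r (c i ℕ.* w x ℕ.+ W)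
  second with supε x | derive-support r c c>0 supε supδ (suc i) (s≤s z≤n) xs
  ... | inj₁ p | _      = inj₁ (trans (cong (ℚ._* D) p) (ℚ.*-zeroˡ D))
  ... | inj₂ _ | inj₁ q = inj₁ (trans (cong (ε x ℚ.*_) q) (ℚ.*-zeroʳ (ε x)))
  ... | inj₂ p | inj₂ q = inj₂ (subst (PositiveMultiple r)
    (cong (ℕ._+ W) (sym (trans (cong (c i ℕ.*_) p) (ℕ.*-zeroʳ (c i))))) q)

  combine : ∀ {p q n} → p ≡ 0ℚ ⊎ PositiveMultiple r n → q ≡ 0ℚ ⊎ PositiveMultiple r n →
            p ℚ.+ q ≡ 0ℚ ⊎ PositiveMultiple r n
  combine (inj₂ p) _        = inj₂ p
  combine (inj₁ _) (inj₂ q) = inj₂ q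
  combine (inj₁ p) (inj₁ q) = inj₁ (trans (cong₂ ℚ._+_ p q) (ℚ.+-identityˡ 0ℚ))

-- Indicators, telescoping sums and sums against a delta.

indicator-yes : ∀ {P : Set} (P? : Dec P) → P → indicator P? ≡ 1ℚ
indicator-yes (yes _) p = refl
indicator-yes (no ¬p) p = contradiction p ¬p

indicator-no : ∀ {P : Set} (P? : Dec P) → ¬ P → indicator P? ≡ 0ℚ
indicator-no (yes p) ¬p = contradiction p ¬p
indicator-no (no _)  ¬p = refl

indicator-× : ∀ {P Q R : Set} (P? : Dec P) (Q? : Dec Q) (R? : Dec R) →
              (P → Q × R) → (Q → R → P) → indicator P? ≡ indicator Q? ℚ.* indicator R?
indicator-× P? (yes q) (yes r) f g = indicator-yes P? (g q r)
indicator-× P? (yes q) (no ¬r) f g = indicator-no P? (¬r ∘ proj₂ ∘ f)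
indicator-× P? (no ¬q) R?      f g =
  trans (indicator-no P? (¬q ∘ proj₁ ∘ f)) (sym (ℚ.*-zeroˡ (indicator R?)))

productℚ-cong : ∀ {f g : A → ℚ} → (∀ x → f x ≡ g x) → ∀ xs → productℚ f xs ≡ productℚ g xs
productℚ-cong f≡g []       = refl
productℚ-cong f≡g (x ∷ xs) = cong₂ ℚ._*_ (f≡g x) (productℚ-cong f≡g xs)

indicator-all : ∀ {P : A → Set} (P? : ∀ x → Dec (P x)) xs →
                indicator (All.all? P? xs) ≡ productℚ (indicator ∘ P?) xs
indicator-all P? []       = refl
indicator-all P? (x ∷ xs) = trans
  (indicator-× (All.all? P? (x ∷ xs)) (P? x) (All.all? P? xs) (λ { (p ∷ ps) → p , ps }) _∷_)
  (cong (indicator (P? x) ℚ.*_) (indicator-all P? xs))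

∑ℚ-upTo-cong : ∀ {f g : ℕ → ℚ} n → (∀ i → i < n → f i ≡ g i) → ∑ℚ (upTo n) f ≡ ∑ℚ (upTo n) g
∑ℚ-upTo-cong n f≡g = ∑ℚ-congᴬ (All.applyUpTo⁺₁ id n (λ {i} → f≡g i))

∑ℚ-upTo-suc : ∀ (f : ℕ → ℚ) n → ∑ℚ (upTo (suc n)) f ≡ f 0 ℚ.+ ∑ℚ (upTo n) (f ∘ suc)
∑ℚ-upTo-suc f n = trans (cong sumℚ (map-upTo f (suc n)))
  (cong (λ xs → f 0 ℚ.+ sumℚ xs) (sym (map-upTo (f ∘ suc) n)))

∑ℚ-telescope : ∀ (f : ℕ → ℚ) n → ∑ℚ (upTo n) (λ i → f i ℚ.- f (suc i)) ≡ f 0 ℚ.- f n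
∑ℚ-telescope f zero    = sym (ℚ.+-inverseʳ (f 0))
∑ℚ-telescope f (suc n) = trans (∑ℚ-upTo-suc (λ i → f i ℚ.- f (suc i)) n)
  (trans (cong ((f 0 ℚ.- f 1) ℚ.+_) (∑ℚ-telescope (f ∘ suc) n))
    (solve 3 (λ a b c → (a :- b) :+ (b :- c) := a :- c) refl (f 0) (f 1) (f (suc n))))

∑ℚ-delta-beyond : ∀ (g : ℕ → ℚ) c n → n ≤ c →
                  ∑ℚ (upTo n) (λ a → indicator (a ℕ.≟ c) ℚ.* g a) ≡ 0ℚ
∑ℚ-delta-beyond g c n n≤c = trans
  (∑ℚ-upTo-cong n (λ a a<n → trans
    (cong (ℚ._* g a) (indicator-no (a ℕ.≟ c) (ℕ.<⇒≢ (ℕ.<-≤-trans a<n n≤c))))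
    (ℚ.*-zeroˡ (g a))))
  (∑ℚ-zero (upTo n))

∑ℚ-delta : ∀ (g : ℕ → ℚ) c n → c < n →
           ∑ℚ (upTo n) (λ a → indicator (a ℕ.≟ c) ℚ.* g a) ≡ g c
∑ℚ-delta g zero    (suc n) _         = trans (∑ℚ-upTo-suc (λ a → indicator (a ℕ.≟ 0) ℚ.* g a) n)
  (trans (cong₂ ℚ._+_
      (ℚ.*-identityˡ (g 0))
      (trans (∑ℚ-cong (upTo n) (λ a → ℚ.*-zeroˡ (g (suc a)))) (∑ℚ-zero (upTo n))))
    (ℚ.+-identityʳ (g 0)))
∑ℚ-delta g (suc c) (suc n) (s≤s c<n) = trans (∑ℚ-upTo-suc (λ a → indicator (a ℕ.≟ suc c) ℚ.* g a) n)
  (trans (cong₂ ℚ._+_ (ℚ.*-zeroˡ (g 0)) (trans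
      (∑ℚ-cong (upTo n) (λ a → cong (ℚ._* g (suc a))
        (indicator-cong (suc a ℕ.≟ suc c) (a ℕ.≟ c) ℕ.suc-injective (cong suc))))
      (∑ℚ-delta (g ∘ suc) c n c<n)))
    (ℚ.+-identityˡ (g (suc c))))

toSupport : ∀ {P : Set} {p} → (¬ P → p ≡ 0ℚ) → Dec P → p ≡ 0ℚ ⊎ P
toSupport f (yes p) = inj₂ p
toSupport f (no ¬p) = inj₁ (f ¬p)

-- One variable: the logarithmic derivative of 1 + x^r.

-- The coefficients of the constant series 1 in one variable, hence the unit for `convolve splitℕ`.
isZero : ℕ → ℚ
isZero e = indicator (e ℕ.≟ 0)

isZero-support : ∀ e → isZero e ≡ 0ℚ ⊎ e ≡ 0
isZero-support e = toSupport (indicator-no (e ℕ.≟ 0)) (e ℕ.≟ 0)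

splitℕ-additive : ∀ e → All (λ (a , b) → a ℕ.+ b ≡ e) (splitℕ e)
splitℕ-additive e = All.map⁺ (All.applyUpTo⁺₁ id (suc e) (λ { (s≤s a≤e) → ℕ.m+[n∸m]≡n a≤e }))

convolve-splitℕ : ∀ f g e →
  convolve splitℕ f g e ≡ ∑ℚ (upTo (suc e)) (λ a → f a ℚ.* g (e ℕ.∸ a))
convolve-splitℕ f g e = ∑ℚ-map (λ (a , b) → f a ℚ.* g b) (λ a → a , e ℕ.∸ a) (upTo (suc e))

splitℕ-counit : Counit splitℕ isZero
splitℕ-counit = left , right
  where
  left : ∀ h e → convolve splitℕ isZero h e ≡ h e
  left h e = trans (convolve-splitℕ isZero h e) (∑ℚ-delta (λ a → h (e ℕ.∸ a)) 0 (suc e) (s≤s z≤n))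

  right : ∀ h e → convolve splitℕ h isZero e ≡ h e
  right h e = trans (convolve-splitℕ h isZero e) (trans
    (∑ℚ-upTo-cong (suc e) λ { a (s≤s a≤e) → trans (ℚ.*-comm (h a) (isZero (e ℕ.∸ a))) (cong (ℚ._* h a)
      (indicator-cong (e ℕ.∸ a ℕ.≟ 0) (a ℕ.≟ e)
        (λ p → ℕ.≤-antisym a≤e (ℕ.m∸n≡0⇒m≤n p)) (λ { refl → ℕ.n∸n≡0 a }))) })
    (∑ℚ-delta h e (suc e) ℕ.≤-refl))

positiveMultiple? : ∀ r n → Dec (PositiveMultiple r n)
positiveMultiple? r n = (r ∣? n) ×-dec (0 ℕ.<? n)

-- The coefficients of r x^r / (1 - x^r); for `r = 1` every positive power has coefficient 1, as the
-- power sums require.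
scaledMultiple : ℕ → ℕ → ℚ
scaledMultiple r e = fromℕ r ℚ.* indicator (positiveMultiple? r e)

-- For e = k r this is (-1)^(k-1) r: the multiples of 2 r are subtracted twice.
signedMultiple : ℕ → ℕ → ℚ
signedMultiple r e = scaledMultiple r e ℚ.- scaledMultiple (2 ℕ.* r) e

scaledMultiple-yes : ∀ r e → PositiveMultiple r e → scaledMultiple r e ≡ fromℕ r
scaledMultiple-yes r e p =
  trans (cong (fromℕ r ℚ.*_) (indicator-yes (positiveMultiple? r e) p)) (ℚ.*-identityʳ (fromℕ r))

scaledMultiple-no : ∀ r e → ¬ PositiveMultiple r e → scaledMultiple r e ≡ 0ℚ
scaledMultiple-no r e ¬p =
  trans (cong (fromℕ r ℚ.*_) (indicator-no (positiveMultiple? r e) ¬p)) (ℚ.*-zeroʳ (fromℕ r))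

signedMultiple-no : ∀ r e → ¬ PositiveMultiple r e → signedMultiple r e ≡ 0ℚ
signedMultiple-no r e ¬p = cong₂ ℚ._-_ (scaledMultiple-no r e ¬p)
  (scaledMultiple-no (2 ℕ.* r) e (λ (d , pos) → ¬p (m*n∣⇒n∣ 2 r d , pos)))

scaledMultiple-support : ∀ r e → scaledMultiple r e ≡ 0ℚ ⊎ PositiveMultiple r e
scaledMultiple-support r e = toSupport (scaledMultiple-no r e) (positiveMultiple? r e)

signedMultiple-support : ∀ r e → signedMultiple r e ≡ 0ℚ ⊎ PositiveMultiple r e
signedMultiple-support r e = toSupport (signedMultiple-no r e) (positiveMultiple? r e)

suc*>0 : ∀ k r .{{_ : NonZero r}} → 0 < suc k ℕ.* r
suc*>0 k (suc r) = s≤s z≤n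

signedMultiple-odd : ∀ r .{{_ : NonZero r}} j → signedMultiple r (suc (j ℕ.* 2) ℕ.* r) ≡ fromℕ r
signedMultiple-odd r j = trans
  (cong₂ ℚ._-_
    (scaledMultiple-yes r _ (n∣m*n (suc (j ℕ.* 2)) , suc*>0 (j ℕ.* 2) r))
    (scaledMultiple-no (2 ℕ.* r) _ (λ (d , _) → 2∤1
      (∣m+n∣m⇒∣n (subst (2 ∣_) (sym (ℕ.+-comm (j ℕ.* 2) 1)) (*-cancelʳ-∣ r d)) (n∣m*n j)))))
  (ℚ.+-identityʳ (fromℕ r))
  where
  2∤1 : ¬ 2 ∣ 1
  2∤1 d with ∣⇒≤ d
  ... | s≤s ()

signedMultiple-even : ∀ r .{{_ : NonZero r}} j →
                      signedMultiple r (suc (suc (j ℕ.* 2)) ℕ.* r) ≡ ℚ.- fromℕ r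
signedMultiple-even r j = trans
  (cong₂ ℚ._-_
    (scaledMultiple-yes r _ (n∣m*n (suc (suc (j ℕ.* 2))) , suc*>0 (suc (j ℕ.* 2)) r))
    (trans (scaledMultiple-yes (2 ℕ.* r) _ (divides (suc j) (ℕ.*-assoc (suc j) 2 r) , suc*>0 (suc (j ℕ.* 2)) r))
      (fromℕ-* 2 r)))
  (solve 1 (λ p → p :- (con (fromℕ 2) :* p) := :- p) refl (fromℕ r))

parity : ∀ k → ∃ λ j → k ≡ j ℕ.* 2 ⊎ k ≡ suc (j ℕ.* 2)
parity zero          = 0 , inj₁ refl
parity (suc zero)    = 0 , inj₂ refl
parity (suc (suc k)) with parity k
... | j , inj₁ p = suc j , inj₁ (cong (suc ∘ suc) p)
... | j , inj₂ p = suc j , inj₂ (cong (suc ∘ suc) p)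

-- Neighbouring positive multiples of `r` carry opposite signs. Positivity of `f` matters: at
-- `f = 0` the second term is 0 while the first is r.
signedMultiple-shift : ∀ r .{{_ : NonZero r}} f → 0 < f →
                       signedMultiple r (r ℕ.+ f) ℚ.+ signedMultiple r f ≡ 0ℚ
signedMultiple-shift r f f>0 = cases f f>0 (r ∣? f)
  where
  cases : ∀ f → 0 < f → Dec (r ∣ f) → signedMultiple r (r ℕ.+ f) ℚ.+ signedMultiple r f ≡ 0ℚ
  cases f f>0 (no r∤f) = cong₂ ℚ._+_
    (signedMultiple-no r (r ℕ.+ f) (λ (d , _) → r∤f (∣m+n∣m⇒∣n d ∣-refl)))
    (signedMultiple-no r f (r∤f ∘ proj₁))
  cases _ f>0 (yes (divides zero refl)) = contradiction f>0 λ ()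
  cases _ f>0 (yes (divides (suc k) refl)) with parity k
  ... | j , inj₁ refl = trans (cong₂ ℚ._+_ (signedMultiple-even r j) (signedMultiple-odd r j))
                              (ℚ.+-inverseˡ (fromℕ r))
  ... | j , inj₂ refl = trans (cong₂ ℚ._+_ (signedMultiple-odd r (suc j)) (signedMultiple-even r j))
                              (ℚ.+-inverseʳ (fromℕ r))

ZeroOr : ℕ → ℕ → Set
ZeroOr r e = e ≡ 0 ⊎ e ≡ r

zeroOr? : ∀ r e → Dec (ZeroOr r e)
zeroOr? r e = (e ℕ.≟ 0) ⊎-dec (e ℕ.≟ r)

-- The coefficients of 1 + x^r.
isZeroOr : ℕ → ℕ → ℚ
isZeroOr r e = indicator (zeroOr? r e)

isZeroOr-sum : ∀ r .{{_ : NonZero r}} e → isZeroOr r e ≡ isZero e ℚ.+ indicator (e ℕ.≟ r)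
isZeroOr-sum r e with e ℕ.≟ 0 | e ℕ.≟ r
... | yes refl | yes refl = contradiction refl (ℕ.≢-nonZero⁻¹ r)
... | yes _    | no _     = refl
... | no _     | yes _    = refl
... | no _     | no _     = refl

-- The logarithmic derivative of 1 + x^r, cleared of its denominator.
splitℕ-leibniz : ∀ r .{{_ : NonZero r}} e →
  convolve splitℕ (isZeroOr r) (signedMultiple r) e ≡ fromℕ e ℚ.* isZeroOr r e
splitℕ-leibniz r e = begin
  convolve splitℕ (isZeroOr r) q e
    ≡⟨ convolve-splitℕ (isZeroOr r) q e ⟩
  ∑ℚ (upTo (suc e)) (λ a → isZeroOr r a ℚ.* q (e ℕ.∸ a))
    ≡⟨ ∑ℚ-cong (upTo (suc e)) (λ a → trans (cong (ℚ._* q (e ℕ.∸ a)) (isZeroOr-sum r a))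
         (ℚ.*-distribʳ-+ (q (e ℕ.∸ a)) (isZero a) _)) ⟩
  ∑ℚ (upTo (suc e)) (λ a → isZero a ℚ.* q (e ℕ.∸ a) ℚ.+ indicator (a ℕ.≟ r) ℚ.* q (e ℕ.∸ a))
    ≡⟨ ∑ℚ-+ (λ a → isZero a ℚ.* q (e ℕ.∸ a)) _ (upTo (suc e)) ⟩
  ∑ℚ (upTo (suc e)) (λ a → isZero a ℚ.* q (e ℕ.∸ a)) ℚ.+
  ∑ℚ (upTo (suc e)) (λ a → indicator (a ℕ.≟ r) ℚ.* q (e ℕ.∸ a))
    ≡⟨ cong (ℚ._+ rest) (∑ℚ-delta (λ a → q (e ℕ.∸ a)) 0 (suc e) (s≤s z≤n)) ⟩
  q e ℚ.+ rest
    ≡⟨ cases (ℕ.<-cmp e r) ⟩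
  fromℕ e ℚ.* isZeroOr r e ∎
  where
  q = signedMultiple r
  rest = ∑ℚ (upTo (suc e)) (λ a → indicator (a ℕ.≟ r) ℚ.* q (e ℕ.∸ a))

  -- `rest` is the contribution of x^r: it is absent for e < r, equals `q 0`, which is 0, for e = r,
  -- and cancels `q e` for e > r.
  cases : Tri (e < r) (e ≡ r) (r < e) → q e ℚ.+ rest ≡ fromℕ e ℚ.* isZeroOr r e
  cases (tri< e<r _ _) = trans
    (cong₂ ℚ._+_
      (signedMultiple-no r e (λ (d , pos) → ℕ.<⇒≱ e<r (∣⇒≤ {{ℕ.>-nonZero pos}} d)))
      (∑ℚ-delta-beyond (λ a → q (e ℕ.∸ a)) r (suc e) e<r))
    (sym (vanish e e<r))
    where
    vanish : ∀ e → e < r → fromℕ e ℚ.* isZeroOr r e ≡ 0ℚ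
    vanish zero    _ = ℚ.*-zeroˡ (isZeroOr r 0)
    vanish (suc e) l = trans (cong (fromℕ (suc e) ℚ.*_) (indicator-no (zeroOr? r (suc e))
      λ { (inj₂ p) → ℕ.<⇒≢ l p })) (ℚ.*-zeroʳ (fromℕ (suc e)))
  cases (tri≈ _ refl _) = begin
    q e ℚ.+ rest                  ≡⟨ cong₂ ℚ._+_
      (trans (cong q (sym (ℕ.*-identityˡ e))) (signedMultiple-odd r 0))
      (∑ℚ-delta (λ a → q (e ℕ.∸ a)) r (suc e) ℕ.≤-refl) ⟩
    fromℕ e ℚ.+ q (e ℕ.∸ e)       ≡⟨ cong (λ n → fromℕ e ℚ.+ q n) (ℕ.n∸n≡0 e) ⟩
    fromℕ e ℚ.+ q 0               ≡⟨ cong (fromℕ e ℚ.+_) (signedMultiple-no r 0 λ ()) ⟩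
    fromℕ e ℚ.+ 0ℚ                ≡⟨ ℚ.+-identityʳ (fromℕ e) ⟩
    fromℕ e                       ≡⟨ sym (ℚ.*-identityʳ (fromℕ e)) ⟩
    fromℕ e ℚ.* 1ℚ                ≡⟨ cong (fromℕ e ℚ.*_) (sym (indicator-yes (zeroOr? e e) (inj₂ refl))) ⟩
    fromℕ e ℚ.* isZeroOr r e      ∎
  cases (tri> _ _ r<e) = begin
    q e ℚ.+ rest
      ≡⟨ cong₂ ℚ._+_ (cong q (sym (ℕ.m+[n∸m]≡n (ℕ.<⇒≤ r<e))))
           (∑ℚ-delta (λ a → q (e ℕ.∸ a)) r (suc e) (ℕ.m<n⇒m<1+n r<e)) ⟩
    q (r ℕ.+ (e ℕ.∸ r)) ℚ.+ q (e ℕ.∸ r)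
      ≡⟨ signedMultiple-shift r (e ℕ.∸ r) (ℕ.m<n⇒0<n∸m r<e) ⟩
    0ℚ
      ≡⟨ sym (ℚ.*-zeroʳ (fromℕ e)) ⟩
    fromℕ e ℚ.* 0ℚ
      ≡⟨ cong (fromℕ e ℚ.*_) (sym (indicator-no (zeroOr? r e)
           λ { (inj₁ refl) → contradiction r<e λ () ; (inj₂ refl) → ℕ.<-irrefl refl r<e })) ⟩
    fromℕ e ℚ.* isZeroOr r e ∎

-- From one exponent to the exponent table.

-- A vanishing sum of naturals with positive coefficients forces every entry to have weight 0, where
-- `f` and `g` agree.
productℚ-weightless : ∀ c {f g : A → ℚ} {w : A → ℕ} → (∀ i → 0 < i → 0 < c i) →
  (∀ x → w x ≡ 0 → f x ≡ g x) → ∀ i → 0 < i → ∀ xs →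
  weightedSum c w i xs ≡ 0 → productℚ f xs ≡ productℚ g xs
productℚ-weightless c c>0 f≡g i i>0 []       _ = refl
productℚ-weightless c {w = w} c>0 f≡g i i>0 (x ∷ xs) p = cong₂ ℚ._*_
  (f≡g x (ℕ.m*n≡0⇒m≡0 (w x) (c i) {{ℕ.>-nonZero (c>0 i i>0)}}
    (trans (ℕ.*-comm (w x) (c i)) (ℕ.m+n≡0⇒m≡0 (c i ℕ.* w x) p))))
  (productℚ-weightless c c>0 f≡g (suc i) (s≤s z≤n) xs (ℕ.m+n≡0⇒n≡0 (c i ℕ.* w x) p))

weightedSum-sum : ∀ i xs → weightedSum (λ _ → 1) id i xs ≡ sum xs
weightedSum-sum i []       = refl
weightedSum-sum i (x ∷ xs) = cong₂ ℕ._+_ (ℕ.+-identityʳ x) (weightedSum-sum (suc i) xs)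

weightedSum-degree : ∀ i m → weightedSum id sum i m ≡ degreeFrom i m
weightedSum-degree i []        = refl
weightedSum-degree i (row ∷ m) = cong (i ℕ.* sum row ℕ.+_) (weightedSum-degree (suc i) m)

1>0 : ∀ (i : ℕ) → 0 < i → 0 < 1
1>0 _ _ = s≤s z≤n

isOneRow : List ℕ → ℚ
isOneRow = productℚ isZero

isOne : Monomial → ℚ
isOne = productℚ isOneRow

deriveRow : (ℕ → ℚ) → List ℕ → ℚ
deriveRow g = derive (λ _ → 1) isZero g 1

deriveFrom : (ℕ → ℚ) → ℕ → Monomial → ℚ
deriveFrom g = derive id isOneRow (deriveRow g)

-- When `g 0` is 0, this takes the value i g(e) at a pure power of x_(i,j) with exponent e > 0 and 0
-- at every other monomial. Starting at 1 undoes the shift of the row indices.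
deriveMonomial : (ℕ → ℚ) → Monomial → ℚ
deriveMonomial g = deriveFrom g 1

-- The coefficients of ∏ (1 + x_(i,j)^r), the sum of E⁺_n(x^r) over all n.
isSquareFreePower : ℕ → Monomial → ℚ
isSquareFreePower r = productℚ (productℚ (isZeroOr r))

splitList-sum : ∀ xs → All (λ (as , bs) → sum as ℕ.+ sum bs ≡ sum xs) (splitList splitℕ xs)
splitList-sum xs = All.map
  (λ {(as , bs)} p → subst₂ (λ x y → x ℕ.+ y ≡ sum xs) (weightedSum-sum 1 as) (weightedSum-sum 1 bs)
    (trans p (weightedSum-sum 1 xs)))
  (splitList-weightedSum (λ _ → 1) splitℕ-additive 1 xs)

factorisations-degree : ∀ m → All (λ (u , v) → degree u ℕ.+ degree v ≡ degree m) (factorisations m)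
factorisations-degree m = All.map
  (λ {(u , v)} p → subst₂ (λ x y → x ℕ.+ y ≡ degree m) (weightedSum-degree 1 u) (weightedSum-degree 1 v)
    (trans p (weightedSum-degree 1 m)))
  (splitList-weightedSum id splitList-sum 1 m)

row-counit : Counit (splitList splitℕ) isOneRow
row-counit = splitList-counit splitℕ-counit

factorisations-counit : Counit factorisations isOne
factorisations-counit = splitList-counit row-counit

isOneRow-support : ∀ xs → isOneRow xs ≡ 0ℚ ⊎ sum xs ≡ 0
isOneRow-support xs = subst (λ n → isOneRow xs ≡ 0ℚ ⊎ n ≡ 0) (weightedSum-sum 1 xs)
  (productℚ-support (λ _ → 1) isZero-support 1 xs)

isOne-supportFrom : ∀ i m → isOne m ≡ 0ℚ ⊎ degreeFrom i m ≡ 0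
isOne-supportFrom i m = subst (λ n → isOne m ≡ 0ℚ ⊎ n ≡ 0) (weightedSum-degree i m)
  (productℚ-support id isOneRow-support i m)

deriveRow-support : ∀ r {g} → (∀ e → g e ≡ 0ℚ ⊎ PositiveMultiple r e) →
  ∀ xs → deriveRow g xs ≡ 0ℚ ⊎ PositiveMultiple r (sum xs)
deriveRow-support r {g} sup xs = subst (λ n → deriveRow g xs ≡ 0ℚ ⊎ PositiveMultiple r n)
  (weightedSum-sum 1 xs)
  (derive-support r (λ _ → 1) {w = id} 1>0 isZero-support sup 1 (s≤s z≤n) xs)

deriveMonomial-support : ∀ r {g} → (∀ e → g e ≡ 0ℚ ⊎ PositiveMultiple r e) →
  ∀ m → deriveMonomial g m ≡ 0ℚ ⊎ PositiveMultiple r (degree m)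
deriveMonomial-support r {g} sup m =
  subst (λ n → deriveMonomial g m ≡ 0ℚ ⊎ PositiveMultiple r n) (weightedSum-degree 1 m)
    (derive-support r id {w = sum} (λ _ → id) isOneRow-support (deriveRow-support r sup) 1 (s≤s z≤n) m)

deriveMonomial-minus : ∀ f g m →
  deriveMonomial (λ e → f e ℚ.- g e) m ≡ deriveMonomial f m ℚ.- deriveMonomial g m
deriveMonomial-minus f g m = trans
  (derive-cong id isOneRow (derive-minus (λ _ → 1) isZero f g 1) 1 m)
  (derive-minus id isOneRow (deriveRow f) (deriveRow g) 1 m)

-- The equation t E′ = E Q for x^r. The Leibniz rule along a row is itself the hypothesis at one
-- position for the rule along the list of rows.
factorisations-leibniz : ∀ r .{{_ : NonZero r}} m →
  convolve factorisations (isSquareFreePower r) (deriveMonomial (signedMultiple r)) m ≡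
  fromℕ (degree m) ℚ.* isSquareFreePower r m
factorisations-leibniz r m = trans
  (splitList-derive id row-counit
    (λ xs → trans (splitList-derive (λ _ → 1) splitℕ-counit (splitℕ-leibniz r) 1 xs)
      (cong (λ n → fromℕ n ℚ.* productℚ (isZeroOr r) xs) (weightedSum-sum 1 xs)))
    1 m)
  (cong (λ n → fromℕ n ℚ.* isSquareFreePower r m) (weightedSum-degree 1 m))

isSquareFreePower-degree-zero : ∀ r m → degree m ≡ 0 → isSquareFreePower r m ≡ isOne m
isSquareFreePower-degree-zero r m p = productℚ-weightless id {productℚ (isZeroOr r)} {isOneRow} {sum} (λ _ → id)
  (λ xs q → productℚ-weightless (λ _ → 1) {isZeroOr r} {isZero} {id} 1>0
    (λ { e refl → refl }) 1 (s≤s z≤n) xs (trans (weightedSum-sum 1 xs) q))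
  1 (s≤s z≤n) m (trans (weightedSum-degree 1 m) p)

-- Coefficients of 1 and of E⁺(x^r) as products over the table.

indicator-allExponents : ∀ {P : ℕ → Set} (P? : ∀ e → Dec (P e)) m →
  indicator (All.all? (All.all? P?) m) ≡ productℚ (productℚ (indicator ∘ P?)) m
indicator-allExponents P? m =
  trans (indicator-all (All.all? P?) m) (productℚ-cong (indicator-all P?) m)

coeff-one : ∀ m → coeff one m ≡ isOne m
coeff-one m = trans
  (indicator-cong (m ≈? []) (All.all? (All.all? (ℕ._≟ 0)) m)
    (λ m≈[] → nth⇒All m λ i → nth⇒All (nth [] m i) λ j → m≈[] i j)
    (λ zs i j → All⇒nth refl (All⇒nth [] zs i) j))
  (indicator-allExponents (ℕ._≟ 0) m)

sum-/ : ∀ r .{{_ : NonZero r}} {xs} → All (r ∣_) xs → r ℕ.* sum (map (_/ r) xs) ≡ sum xs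
sum-/ r []                   = ℕ.*-zeroʳ r
sum-/ r {x ∷ xs} (r∣x ∷ r∣xs) = trans (ℕ.*-distribˡ-+ r (x / r) (sum (map (_/ r) xs)))
  (cong₂ ℕ._+_ (trans (ℕ.*-comm r (x / r)) (m/n*n≡m r∣x)) (sum-/ r r∣xs))

degreeFrom-/ : ∀ r .{{_ : NonZero r}} i {m} → AllExponents (r ∣_) m →
               r ℕ.* degreeFrom i (map (map (_/ r)) m) ≡ degreeFrom i m
degreeFrom-/ r i []             = ℕ.*-zeroʳ r
degreeFrom-/ r i {row ∷ m} (d ∷ ds) = trans
  (ℕ.*-distribˡ-+ r (i ℕ.* sum (map (_/ r) row)) _)
  (cong₂ ℕ._+_
    (trans (x∙yz≈y∙xz r i _) (cong (i ℕ.*_) (sum-/ r d)))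
    (degreeFrom-/ r (suc i) ds))

∣∧/≤1⇒zeroOr : ∀ r .{{_ : NonZero r}} e → r ∣ e → e / r ≤ 1 → ZeroOr r e
∣∧/≤1⇒zeroOr r e r∣e q≤1 with e / r in eq
... | zero     = inj₁ (trans (sym (m/n*n≡m r∣e)) (cong (ℕ._* r) eq))
... | suc zero = inj₂ (trans (sym (m/n*n≡m r∣e)) (trans (cong (ℕ._* r) eq) (ℕ.*-identityˡ r)))
∣∧/≤1⇒zeroOr r e r∣e (s≤s ()) | suc (suc _)

zeroOr⇒∣ : ∀ {r e} → ZeroOr r e → r ∣ e
zeroOr⇒∣ {r} (inj₁ refl) = r ∣0
zeroOr⇒∣ (inj₂ refl) = ∣-refl

zeroOr⇒/≤1 : ∀ {r} .{{_ : NonZero r}} {e} → ZeroOr r e → e / r ≤ 1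
zeroOr⇒/≤1 {r} (inj₁ refl) = ℕ.≤-trans (ℕ.≤-reflexive (0/n≡0 r)) z≤n
zeroOr⇒/≤1 {r} (inj₂ refl) = ℕ.≤-reflexive (n/n≡1 r)

-- Divisibility by `r` together with square-freeness of the quotients says that each exponent is 0
-- or `r`, a condition on single entries; on such monomials division by `r` scales the degree.
coeff-E⁺ : ∀ r .{{_ : NonZero r}} n m →
  coeff (E⁺ n ⟨x^ r ⟩) m ≡ isSquareFreePower r m ℚ.* indicator (degree m ℕ.≟ r ℕ.* n)
coeff-E⁺ r n m = begin
  indicator r∣m? ℚ.* indicator sf?
    ≡⟨ sym (indicator-× (r∣m? ×-dec sf?) r∣m? sf? id _,_) ⟩
  indicator (r∣m? ×-dec sf?)
    ≡⟨ indicator-× (r∣m? ×-dec sf?) zo? (degree m ℕ.≟ r ℕ.* n)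
         (λ (d , sf , deg) →
           All.zipWith (λ (d , sf) → All.zipWith (λ (d , q) → ∣∧/≤1⇒zeroOr r _ d q) (d , All.map⁻ sf))
                       (d , All.map⁻ sf) ,
           trans (sym (degreeFrom-/ r 1 d)) (cong (r ℕ.*_) deg))
         (λ zo deg → let d = All.map (All.map zeroOr⇒∣) zo in
           d , All.map⁺ (All.map (All.map⁺ ∘ All.map zeroOr⇒/≤1) zo) ,
           ℕ.*-cancelˡ-≡ _ _ r (trans (degreeFrom-/ r 1 d) deg)) ⟩
  indicator zo? ℚ.* indicator (degree m ℕ.≟ r ℕ.* n)
    ≡⟨ cong (ℚ._* indicator (degree m ℕ.≟ r ℕ.* n)) (indicator-allExponents (zeroOr? r) m) ⟩
  isSquareFreePower r m ℚ.* indicator (degree m ℕ.≟ r ℕ.* n) ∎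
  where
  r∣m? = All.all? (All.all? (r ∣?_)) m
  sf?  = squareFree? (map (map (_/ r)) m) ×-dec (degree (map (map (_/ r)) m) ℕ.≟ n)
  zo?  = All.all? (All.all? (zeroOr? r)) m

indicator-subst : ∀ (f : ℕ → ℚ) m n → indicator (m ℕ.≟ n) ℚ.* f m ≡ indicator (m ℕ.≟ n) ℚ.* f n
indicator-subst f m n = cases (m ℕ.≟ n)
  where
  cases : (d : Dec (m ≡ n)) → indicator d ℚ.* f m ≡ indicator d ℚ.* f n
  cases (yes p) = cong (λ k → 1ℚ ℚ.* f k) p
  cases (no _)  = trans (ℚ.*-zeroˡ (f m)) (sym (ℚ.*-zeroˡ (f n)))

indicator-guard : ∀ {P : Set} (P? : Dec P) {p q} → (P → p ≡ q) →
                  indicator P? ℚ.* p ≡ indicator P? ℚ.* q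
indicator-guard (yes x) f = cong (1ℚ ℚ.*_) (f x)
indicator-guard (no _) {p} {q} f = trans (ℚ.*-zeroˡ p) (sym (ℚ.*-zeroˡ q))

-- The sum over compositions for a fixed multiplicity r.

last-∷⁺ : ∀ (x : A) c → List⁺.last (x ∷⁺ c) ≡ List⁺.last c
last-∷⁺ x (y ∷ ys) with initLast ys
... | []       = refl
... | zs ∷ʳ′ z = refl

compositionSign : List⁺ ℕ → ℤ
compositionSign c = -1ℤ ℤ.^ (length (toList c) ℕ.∸ 1)

-- The summand of the theorem for the polycomposition c^r, at one monomial and for any r ≥ 1.
compositionTerm : (r : ℕ) → .{{NonZero r}} → List⁺ ℕ → Monomial → ℚ
compositionTerm r c m = fromℤ (compositionSign c ℤ.* (+ (r ℕ.* List⁺.last c))) ℚ.*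
                        coeff (∏ (map (λ d → E⁺ d ⟨x^ r ⟩) (toList c))) m

-- Under the indicator the weight r d equals the degree of `m`, which puts the term into the form of
-- t E′ produced by the Leibniz rule.
compositionTerm-single : ∀ r .{{_ : NonZero r}} d m →
  compositionTerm r (d ∷ []) m ≡
  indicator (degree m ℕ.≟ r ℕ.* d) ℚ.* (fromℕ (degree m) ℚ.* isSquareFreePower r m)
compositionTerm-single r d m = begin
  fromℤ (+ 1 ℤ.* (+ (r ℕ.* d))) ℚ.* convolve factorisations (coeff E) (coeff one) m
    ≡⟨ cong₂ ℚ._*_ (cong fromℤ (ℤ.*-identityˡ (+ (r ℕ.* d))))
         (trans (∑ℚ-cong (factorisations m) (λ (u , v) → cong (coeff E u ℚ.*_) (coeff-one v)))
           (trans (proj₂ factorisations-counit (coeff E) m) (coeff-E⁺ r d m))) ⟩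
  fromℕ (r ℕ.* d) ℚ.* (S ℚ.* I)
    ≡⟨ solve 3 (λ a s i → a :* (s :* i) := (i :* a) :* s) refl (fromℕ (r ℕ.* d)) S I ⟩
  (I ℚ.* fromℕ (r ℕ.* d)) ℚ.* S
    ≡⟨ cong (ℚ._* S) (sym (indicator-subst fromℕ (degree m) (r ℕ.* d))) ⟩
  (I ℚ.* fromℕ (degree m)) ℚ.* S
    ≡⟨ ℚ.*-assoc I (fromℕ (degree m)) S ⟩
  I ℚ.* (fromℕ (degree m) ℚ.* S) ∎
  where
  E = E⁺ d ⟨x^ r ⟩
  S = isSquareFreePower r m
  I = indicator (degree m ℕ.≟ r ℕ.* d)

-- The last part belongs to the non-empty tail `c`, so the new part only adds a left factor and a
-- sign. This is the recursion step for the sum over compositions.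
compositionTerm-∷⁺ : ∀ r .{{_ : NonZero r}} d c m →
  compositionTerm r (d ∷⁺ c) m ≡
  ℚ.- convolve factorisations (coeff (E⁺ d ⟨x^ r ⟩)) (compositionTerm r c) m
compositionTerm-∷⁺ r d c m = begin
  fromℤ ((-1ℤ ℤ.* compositionSign c) ℤ.* (+ (r ℕ.* List⁺.last (d ∷⁺ c)))) ℚ.* C
    ≡⟨ cong (λ n → fromℤ ((-1ℤ ℤ.* compositionSign c) ℤ.* (+ (r ℕ.* n))) ℚ.* C) (last-∷⁺ d c) ⟩
  fromℤ ((-1ℤ ℤ.* compositionSign c) ℤ.* (+ (r ℕ.* List⁺.last c))) ℚ.* C
    ≡⟨ cong (ℚ._* C) (trans (cong fromℤ (ℤ.*-assoc -1ℤ (compositionSign c) _))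
         (fromℤ-* -1ℤ (compositionSign c ℤ.* (+ (r ℕ.* List⁺.last c))))) ⟩
  (fromℤ -1ℤ ℚ.* k) ℚ.* C
    ≡⟨ solve 2 (λ k C → (con (fromℤ -1ℤ) :* k) :* C := :- (k :* C)) refl k C ⟩
  ℚ.- (k ℚ.* C)
    ≡⟨ cong ℚ.-_ (sym (trans
         (∑ℚ-cong (factorisations m) (λ (u , v) →
           solve 3 (λ e k x → e :* (k :* x) := k :* (e :* x)) refl (E u) k (X v)))
         (∑ℚ-*ˡ k (λ (u , v) → E u ℚ.* X v) (factorisations m)))) ⟩
  ℚ.- convolve factorisations E (compositionTerm r c) m ∎
  where
  E = coeff (E⁺ d ⟨x^ r ⟩)
  X = coeff (∏ (map (λ d → E⁺ d ⟨x^ r ⟩) (toList c)))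
  C = convolve factorisations E X m
  k = fromℤ (compositionSign c ℤ.* (+ (r ℕ.* List⁺.last c)))

∑ℚ-neg : ∀ (f : A → ℚ) xs → ∑ℚ xs (λ x → ℚ.- f x) ≡ ℚ.- ∑ℚ xs f
∑ℚ-neg f []       = refl
∑ℚ-neg f (x ∷ xs) = trans (cong (ℚ.- f x ℚ.+_) (∑ℚ-neg f xs)) (sym (ℚ.neg-distrib-+ (f x) _))

convolve-∑ℚ : ∀ (s : A → List (A × A)) (f : A → ℚ) (g : B → A → ℚ) ys x →
  ∑ℚ ys (λ y → convolve s f (g y) x) ≡ convolve s f (λ a → ∑ℚ ys (λ y → g y a)) x
convolve-∑ℚ s f g ys x = trans (∑ℚ-swap (λ y (a , b) → f a ℚ.* g y b) ys (s x))
  (∑ℚ-cong (s x) (λ (a , b) → ∑ℚ-*ˡ (f a) (λ y → g y b) ys))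

convolve-cong : ∀ (s : A → List (A × A)) {f g h k : A → ℚ} → (∀ x → f x ≡ g x) →
  (∀ x → h x ≡ k x) → ∀ x → convolve s f h x ≡ convolve s g k x
convolve-cong s f≡g h≡k x = ∑ℚ-cong (s x) (λ (a , b) → cong₂ ℚ._*_ (f≡g a) (h≡k b))

-- The tail of E Q in which Q contributes degree above r n: what is left of t E′ after the
-- compositions with a smaller remainder have been subtracted.
truncatedLeibniz : ℕ → ℕ → Monomial → ℚ
truncatedLeibniz r n = convolve factorisations (isSquareFreePower r)
  (λ v → deriveMonomial (signedMultiple r) v ℚ.* indicator (r ℕ.* n ℕ.<? degree v))

module _ (r : ℕ) .{{r≢0 : NonZero r}} where

  private
    S D : Monomial → ℚ
    S = isSquareFreePower r
    D = deriveMonomial (signedMultiple r)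

    -- The support of `D` as an eliminator: the motive takes `D v` and `degree v` as variables, so
    -- both can be replaced together inside a goal.
    D-cases : ∀ (Q : ℚ → ℕ → Set) → (∀ n → Q 0ℚ n) → (∀ p t → Q p (r ℕ.* suc t)) → ∀ v → Q (D v) (degree v)
    D-cases Q z q v with D v | degree v | deriveMonomial-support r (signedMultiple-support r) v
    ... | _ | n | inj₁ refl = z n
    ... | p | _ | inj₂ (divides zero refl , pos)    = contradiction pos λ ()
    ... | p | _ | inj₂ (divides (suc t) refl , pos) = subst (Q p) (ℕ.*-comm r (suc t)) (q p t)

  -- `D` lives in positive degrees, so the cutoff at 0 removes nothing and the full Leibniz rule
  -- applies.
  truncatedLeibniz-zero : ∀ m → truncatedLeibniz r 0 m ≡ fromℕ (degree m) ℚ.* S m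
  truncatedLeibniz-zero m = trans
    (convolve-cong factorisations {S} {S} (λ _ → refl)
      (D-cases (λ p n → p ℚ.* indicator (r ℕ.* 0 ℕ.<? n) ≡ p)
        (λ n → ℚ.*-zeroˡ (indicator (r ℕ.* 0 ℕ.<? n)))
        (λ p t → trans (cong (p ℚ.*_) (indicator-yes (r ℕ.* 0 ℕ.<? r ℕ.* suc t)
          (ℕ.*-monoʳ-< r (s≤s z≤n)))) (ℚ.*-identityʳ p))) m)
    (factorisations-leibniz r m)

  -- On the support of `D` degrees are multiples of r, so the only degree between the two cutoffs is
  -- r (n + 1).
  truncatedLeibniz-suc : ∀ n m → truncatedLeibniz r n m ≡
    truncatedLeibniz r (suc n) m ℚ.+
    convolve factorisations S (λ v → D v ℚ.* indicator (degree v ℕ.≟ r ℕ.* suc n)) m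
  truncatedLeibniz-suc n m = trans
    (∑ℚ-cong (factorisations m) (λ (u , v) → trans
      (cong (S u ℚ.*_) (D-cases
        (λ p k → p ℚ.* indicator (r ℕ.* n ℕ.<? k) ≡
                 p ℚ.* indicator (r ℕ.* suc n ℕ.<? k) ℚ.+ p ℚ.* indicator (k ℕ.≟ r ℕ.* suc n))
        (λ k → solve 3 (λ a b c → con 0ℚ :* a := con 0ℚ :* b :+ con 0ℚ :* c) refl
          (indicator (r ℕ.* n ℕ.<? k)) (indicator (r ℕ.* suc n ℕ.<? k)) (indicator (k ℕ.≟ r ℕ.* suc n)))
        (λ p t → trans (cong (p ℚ.*_) (step t)) (ℚ.*-distribˡ-+ p _ _)) v))
      (ℚ.*-distribˡ-+ (S u) _ _)))
    (∑ℚ-+ (λ (u , v) → S u ℚ.* (D v ℚ.* indicator (r ℕ.* suc n ℕ.<? degree v)))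
          (λ (u , v) → S u ℚ.* (D v ℚ.* indicator (degree v ℕ.≟ r ℕ.* suc n))) (factorisations m))
    where
    step : ∀ t → indicator (r ℕ.* n ℕ.<? r ℕ.* suc t) ≡
                 indicator (r ℕ.* suc n ℕ.<? r ℕ.* suc t) ℚ.+ indicator (r ℕ.* suc t ℕ.≟ r ℕ.* suc n)
    step t with ℕ.<-cmp n t
    ... | tri< n<t n≢t _ = trans
      (indicator-yes (r ℕ.* n ℕ.<? r ℕ.* suc t) (ℕ.*-monoʳ-< r (ℕ.m<n⇒m<1+n n<t)))
      (sym (cong₂ ℚ._+_
        (indicator-yes (r ℕ.* suc n ℕ.<? r ℕ.* suc t) (ℕ.*-monoʳ-< r (s≤s n<t)))
        (indicator-no (r ℕ.* suc t ℕ.≟ r ℕ.* suc n)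
          (λ p → n≢t (sym (ℕ.suc-injective (ℕ.*-cancelˡ-≡ _ _ r p)))))))
    ... | tri≈ _ refl _ = trans
      (indicator-yes (r ℕ.* n ℕ.<? r ℕ.* suc n) (ℕ.*-monoʳ-< r ℕ.≤-refl))
      (sym (cong₂ ℚ._+_
        (indicator-no (r ℕ.* suc n ℕ.<? r ℕ.* suc n) (ℕ.<-irrefl refl))
        (indicator-yes (r ℕ.* suc n ℕ.≟ r ℕ.* suc n) refl)))
    ... | tri> _ n≢t t<n = trans
      (indicator-no (r ℕ.* n ℕ.<? r ℕ.* suc t) (ℕ.≤⇒≯ (ℕ.*-monoʳ-≤ r t<n)))
      (sym (cong₂ ℚ._+_
        (indicator-no (r ℕ.* suc n ℕ.<? r ℕ.* suc t) (ℕ.≤⇒≯ (ℕ.*-monoʳ-≤ r (s≤s (ℕ.<⇒≤ t<n)))))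
        (indicator-no (r ℕ.* suc t ℕ.≟ r ℕ.* suc n)
          (λ p → n≢t (sym (ℕ.suc-injective (ℕ.*-cancelˡ-≡ _ _ r p)))))))

  -- The cutoff is one step below the degree of `m`, so v must take the whole degree and u must be
  -- 1.
  truncatedLeibniz-top : ∀ n m → degree m ≡ r ℕ.* suc n → truncatedLeibniz r n m ≡ D m
  truncatedLeibniz-top n m deg = trans
    (∑ℚ-congᴬ (All.map (λ {(u , v)} p → summand u v (trans p deg)) (factorisations-degree m)))
    (proj₁ factorisations-counit D m)
    where
    summand : ∀ u v → degree u ℕ.+ degree v ≡ r ℕ.* suc n →
      S u ℚ.* (D v ℚ.* indicator (r ℕ.* n ℕ.<? degree v)) ≡ isOne u ℚ.* D v
    summand u v = D-cases
      (λ p k → degree u ℕ.+ k ≡ r ℕ.* suc n →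
        S u ℚ.* (p ℚ.* indicator (r ℕ.* n ℕ.<? k)) ≡ isOne u ℚ.* p)
      (λ k _ → solve 3 (λ s o i → s :* (con 0ℚ :* i) := o :* con 0ℚ) refl (S u) (isOne u)
        (indicator (r ℕ.* n ℕ.<? k)))
      positive v
      where
      positive : ∀ p t → degree u ℕ.+ r ℕ.* suc t ≡ r ℕ.* suc n →
        S u ℚ.* (p ℚ.* indicator (r ℕ.* n ℕ.<? r ℕ.* suc t)) ≡ isOne u ℚ.* p
      positive p t eq with ℕ.<-cmp t n
      -- The degree r (t + 1) of v does not exceed the cutoff, so the left side is 0; u has positive
      -- degree, so `isOne u` is 0 as well.
      ... | tri< t<n t≢n _ = trans
        (trans (cong (λ i → S u ℚ.* (p ℚ.* i))
            (indicator-no (r ℕ.* n ℕ.<? r ℕ.* suc t) (ℕ.≤⇒≯ (ℕ.*-monoʳ-≤ r t<n))))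
          (solve 2 (λ s p → s :* (p :* con 0ℚ) := con 0ℚ) refl (S u) p))
        (sym (trans (cong (ℚ._* p) isOne≡0) (ℚ.*-zeroˡ p)))
        where
        isOne≡0 : isOne u ≡ 0ℚ
        isOne≡0 with isOne-supportFrom 1 u
        ... | inj₁ z = z
        ... | inj₂ z = contradiction
          (ℕ.suc-injective (ℕ.*-cancelˡ-≡ _ _ r (trans (cong (ℕ._+ r ℕ.* suc t) (sym z)) eq))) t≢n
      -- Now u has degree 0, where the coefficients of E agree with the unit.
      ... | tri≈ _ refl _ = cong₂ ℚ._*_
        (isSquareFreePower-degree-zero r u (ℕ.+-cancelʳ-≡ (r ℕ.* suc t) (degree u) 0 eq))
        (trans (cong (p ℚ.*_) (indicator-yes (r ℕ.* n ℕ.<? r ℕ.* suc n) (ℕ.*-monoʳ-< r ℕ.≤-refl)))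
               (ℚ.*-identityʳ p))
      ... | tri> _ _ n<t = contradiction
        (ℕ.≤-trans (ℕ.m≤n+m (r ℕ.* suc t) (degree u)) (ℕ.≤-reflexive eq))
        (ℕ.<⇒≱ (ℕ.*-monoʳ-< r (s≤s n<t)))

  -- Mutual induction with the next lemma. A first part equal to a + 1 is followed by a composition
  -- of n, for positive n, and contributes -E⁺_(a+1) Q_n; this is exactly the difference of the
  -- truncations for n and n - 1, the latter coming from first parts at least a + 2.
  ∑-compositionsFrom : ∀ a n m → ∑ℚ (compositionsFrom a n) (λ c → compositionTerm r c m) ≡
    indicator (degree m ℕ.≟ r ℕ.* (suc a ℕ.+ n)) ℚ.* truncatedLeibniz r n m

  ∑-compositions : ∀ n m → ∑ℚ (compositionsFrom 0 n) (λ c → compositionTerm r c m) ≡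
    indicator (degree m ℕ.≟ r ℕ.* suc n) ℚ.* D m

  ∑-compositionsFrom a zero m = begin
    compositionTerm r (suc a ∷ []) m ℚ.+ 0ℚ
      ≡⟨ ℚ.+-identityʳ (compositionTerm r (suc a ∷ []) m) ⟩
    compositionTerm r (suc a ∷ []) m
      ≡⟨ compositionTerm-single r (suc a) m ⟩
    indicator (degree m ℕ.≟ r ℕ.* suc a) ℚ.* (fromℕ (degree m) ℚ.* S m)
      ≡⟨ cong₂ (λ k p → indicator (degree m ℕ.≟ r ℕ.* k) ℚ.* p) (sym (ℕ.+-identityʳ (suc a)))
           (sym (truncatedLeibniz-zero m)) ⟩
    indicator (degree m ℕ.≟ r ℕ.* (suc a ℕ.+ 0)) ℚ.* truncatedLeibniz r 0 m ∎
  ∑-compositionsFrom a (suc n) m = begin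
    ∑ℚ (map (suc a ∷⁺_) (compositionsFrom 0 n) ++ compositionsFrom (suc a) n) (λ c → compositionTerm r c m)
      ≡⟨ ∑ℚ-++ (λ c → compositionTerm r c m) (map (suc a ∷⁺_) (compositionsFrom 0 n)) (compositionsFrom (suc a) n) ⟩
    ∑ℚ (map (suc a ∷⁺_) (compositionsFrom 0 n)) (λ c → compositionTerm r c m) ℚ.+
    ∑ℚ (compositionsFrom (suc a) n) (λ c → compositionTerm r c m)
      ≡⟨ cong₂ ℚ._+_ prepended (∑-compositionsFrom (suc a) n m) ⟩
    ℚ.- (I ℚ.* U) ℚ.+ indicator (degree m ℕ.≟ r ℕ.* (suc (suc a) ℕ.+ n)) ℚ.* truncatedLeibniz r n m
      -- Both groups of compositions have the same total, (a + 2) + n = (a + 1) + (n + 1), so both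
      -- carry the indicator `I` and `U` cancels.
      ≡⟨ cong₂ (λ k p → ℚ.- (I ℚ.* U) ℚ.+ indicator (degree m ℕ.≟ r ℕ.* k) ℚ.* p)
           (cong suc (sym (ℕ.+-suc a n))) (truncatedLeibniz-suc n m) ⟩
    ℚ.- (I ℚ.* U) ℚ.+ I ℚ.* (truncatedLeibniz r (suc n) m ℚ.+ U)
      ≡⟨ solve 3 (λ i u t → :- (i :* u) :+ i :* (t :+ u) := i :* t) refl I U (truncatedLeibniz r (suc n) m) ⟩
    I ℚ.* truncatedLeibniz r (suc n) m ∎
    where
    I = indicator (degree m ℕ.≟ r ℕ.* (suc a ℕ.+ suc n))
    U = convolve factorisations S (λ v → D v ℚ.* indicator (degree v ℕ.≟ r ℕ.* suc n)) m
    E = coeff (E⁺ (suc a) ⟨x^ r ⟩)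

    -- Once the degree of v is fixed, additivity of the degree turns the condition on u into a
    -- condition on `m`, which can be taken out of the sum.
    graded : ∀ u v → degree u ℕ.+ degree v ≡ degree m →
      (S u ℚ.* indicator (degree u ℕ.≟ r ℕ.* suc a)) ℚ.* (indicator (degree v ℕ.≟ r ℕ.* suc n) ℚ.* D v) ≡
      I ℚ.* (S u ℚ.* (D v ℚ.* indicator (degree v ℕ.≟ r ℕ.* suc n)))
    graded u v eq = begin
      (S u ℚ.* Iᵤ) ℚ.* (Iᵥ ℚ.* D v)
        ≡⟨ solve 4 (λ s j k d → (s :* j) :* (k :* d) := (k :* j) :* (s :* d)) refl (S u) Iᵤ Iᵥ (D v) ⟩
      (Iᵥ ℚ.* Iᵤ) ℚ.* (S u ℚ.* D v)
        ≡⟨ cong (ℚ._* (S u ℚ.* D v)) (indicator-guard (degree v ℕ.≟ r ℕ.* suc n) λ p →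
             indicator-cong (degree u ℕ.≟ r ℕ.* suc a) (degree m ℕ.≟ r ℕ.* (suc a ℕ.+ suc n))
               (λ q → trans (sym eq) (trans (cong₂ ℕ._+_ q p) (sym (ℕ.*-distribˡ-+ r (suc a) (suc n)))))
               (λ q → ℕ.+-cancelʳ-≡ (degree v) _ _ (trans eq (trans q (trans
                 (ℕ.*-distribˡ-+ r (suc a) (suc n)) (cong (r ℕ.* suc a ℕ.+_) (sym p))))))) ⟩
      (Iᵥ ℚ.* I) ℚ.* (S u ℚ.* D v)
        ≡⟨ solve 4 (λ s i k d → (k :* i) :* (s :* d) := i :* (s :* (d :* k))) refl (S u) I Iᵥ (D v) ⟩
      I ℚ.* (S u ℚ.* (D v ℚ.* Iᵥ)) ∎
      where
      Iᵤ = indicator (degree u ℕ.≟ r ℕ.* suc a)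
      Iᵥ = indicator (degree v ℕ.≟ r ℕ.* suc n)

    prepended : ∑ℚ (map (suc a ∷⁺_) (compositionsFrom 0 n)) (λ c → compositionTerm r c m) ≡ ℚ.- (I ℚ.* U)
    prepended = begin
      ∑ℚ (map (suc a ∷⁺_) (compositionsFrom 0 n)) (λ c → compositionTerm r c m)
        ≡⟨ ∑ℚ-map (λ c → compositionTerm r c m) (suc a ∷⁺_) (compositionsFrom 0 n) ⟩
      ∑ℚ (compositionsFrom 0 n) (λ c → compositionTerm r (suc a ∷⁺ c) m)
        ≡⟨ ∑ℚ-cong (compositionsFrom 0 n) (λ c → compositionTerm-∷⁺ r (suc a) c m) ⟩
      ∑ℚ (compositionsFrom 0 n) (λ c → ℚ.- convolve factorisations E (compositionTerm r c) m)
        ≡⟨ ∑ℚ-neg (λ c → convolve factorisations E (compositionTerm r c) m) (compositionsFrom 0 n) ⟩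
      ℚ.- ∑ℚ (compositionsFrom 0 n) (λ c → convolve factorisations E (compositionTerm r c) m)
        ≡⟨ cong ℚ.-_ (convolve-∑ℚ factorisations E (compositionTerm r) (compositionsFrom 0 n) m) ⟩
      ℚ.- convolve factorisations E (λ v → ∑ℚ (compositionsFrom 0 n) (λ c → compositionTerm r c v)) m
        ≡⟨ cong ℚ.-_ (convolve-cong factorisations (coeff-E⁺ r (suc a)) (∑-compositions n) m) ⟩
      ℚ.- convolve factorisations (λ u → S u ℚ.* indicator (degree u ℕ.≟ r ℕ.* suc a))
                                  (λ v → indicator (degree v ℕ.≟ r ℕ.* suc n) ℚ.* D v) m
        ≡⟨ cong ℚ.-_ (trans
             (∑ℚ-congᴬ (All.map (λ {(u , v)} → graded u v) (factorisations-degree m)))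
             (∑ℚ-*ˡ I (λ (u , v) → S u ℚ.* (D v ℚ.* indicator (degree v ℕ.≟ r ℕ.* suc n))) (factorisations m))) ⟩
      ℚ.- (I ℚ.* U) ∎

  ∑-compositions n m = trans (∑-compositionsFrom 0 n m)
    (indicator-guard (degree m ℕ.≟ r ℕ.* suc n) (truncatedLeibniz-top n m))

-- Coefficients of the power sum P.

rowPower : ℕ → ℕ → List ℕ
rowPower j e = replicate j 0 ++ [ e ]

_≈ʳ?_ : ∀ xs ys → Dec (Padded _≡_ 0 xs ys)
_≈ʳ?_ = padded? refl ℕ._≟_

isOneRow-indicator : ∀ xs → isOneRow xs ≡ indicator (All.all? (ℕ._≟ 0) xs)
isOneRow-indicator xs = sym (indicator-all (ℕ._≟ 0) xs)

isOne-indicator : ∀ m → isOne m ≡ indicator (All.all? (All.all? (ℕ._≟ 0)) m)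
isOne-indicator m = sym (indicator-allExponents (ℕ._≟ 0) m)

-- Serves to trade a condition on one part of a table for the same condition on the total weight:
-- where the factor `s` is nonzero, the rest has weight 0.
guardedBySupport : ∀ {P Q R : Set} (P? : Dec P) (Q? : Dec Q) {s : ℚ} → s ≡ 0ℚ ⊎ R →
  (R → P → Q) → (R → Q → P) → indicator P? ℚ.* s ≡ indicator Q? ℚ.* s
guardedBySupport P? Q? (inj₁ refl) f g = trans (ℚ.*-zeroʳ (indicator P?)) (sym (ℚ.*-zeroʳ (indicator Q?)))
guardedBySupport P? Q? {s} (inj₂ r) f g = cong (ℚ._* s) (indicator-cong P? Q? (f r) (g r))

-- Position j = 0 requires a head `e` and a zero tail, the later positions a zero head and a power
-- in the tail: these are the two summands of `derive`. Positions beyond the row give nothing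
-- because e > 0.
∑-rowPower : ∀ e → 0 < e → ∀ i row b → length row ≤ b →
  ∑ℚ (upTo b) (λ j → indicator (row ≈ʳ? rowPower j e)) ≡
  indicator (sum row ℕ.≟ e) ℚ.* derive (λ _ → 1) isZero (scaledMultiple 1) i row
∑-rowPower e e>0 i [] b _ = trans
  (∑ℚ-cong (upTo b) (λ j → indicator-no ([] ≈ʳ? rowPower j e) λ p →
    ℕ.<⇒≢ e>0 (trans (p j) (nth-rowPower j))))
  (trans (∑ℚ-zero (upTo b)) (sym (ℚ.*-zeroʳ (indicator (0 ℕ.≟ e)))))
  where
  nth-rowPower : ∀ j → nth 0 (rowPower j e) j ≡ e
  nth-rowPower zero    = refl
  nth-rowPower (suc j) = nth-rowPower j
∑-rowPower e e>0 i (x ∷ xs) (suc b) (s≤s len≤b) = begin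
  ∑ℚ (upTo (suc b)) (λ j → indicator ((x ∷ xs) ≈ʳ? rowPower j e))
    ≡⟨ ∑ℚ-upTo-suc (λ j → indicator ((x ∷ xs) ≈ʳ? rowPower j e)) b ⟩
  indicator ((x ∷ xs) ≈ʳ? [ e ]) ℚ.+ ∑ℚ (upTo b) (λ j → indicator ((x ∷ xs) ≈ʳ? rowPower (suc j) e))
    ≡⟨ cong₂ ℚ._+_ here-case there-case ⟩
  T ℚ.* (1ℚ ℚ.* p x ℚ.* O) ℚ.+ T ℚ.* (isZero x ℚ.* D)
    ≡⟨ sym (ℚ.*-distribˡ-+ T (1ℚ ℚ.* p x ℚ.* O) (isZero x ℚ.* D)) ⟩
  T ℚ.* (1ℚ ℚ.* p x ℚ.* O ℚ.+ isZero x ℚ.* D) ∎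
  where
  p = scaledMultiple 1
  T = indicator (x ℕ.+ sum xs ℕ.≟ e)
  O = isOneRow xs
  D = derive (λ _ → 1) isZero p (suc i) xs

  here-case : indicator ((x ∷ xs) ≈ʳ? [ e ]) ≡ T ℚ.* (1ℚ ℚ.* p x ℚ.* O)
  here-case = begin
    indicator ((x ∷ xs) ≈ʳ? [ e ])
      ≡⟨ indicator-× ((x ∷ xs) ≈ʳ? [ e ]) (x ℕ.≟ e) (All.all? (ℕ._≟ 0) xs)
           (λ p → p 0 , nth⇒All xs (p ∘ suc))
           (λ { q zs zero → q ; q zs (suc j) → All⇒nth refl zs j }) ⟩
    indicator (x ℕ.≟ e) ℚ.* indicator (All.all? (ℕ._≟ 0) xs)
      ≡⟨ cong (indicator (x ℕ.≟ e) ℚ.*_) (sym (isOneRow-indicator xs)) ⟩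
    indicator (x ℕ.≟ e) ℚ.* O
      ≡⟨ guardedBySupport (x ℕ.≟ e) (x ℕ.+ sum xs ℕ.≟ e) (isOneRow-support xs)
           (λ z q → trans (cong (x ℕ.+_) z) (trans (ℕ.+-identityʳ x) q))
           (λ z q → trans (sym (ℕ.+-identityʳ x)) (trans (cong (x ℕ.+_) (sym z)) q)) ⟩
    T ℚ.* O
      ≡⟨ weight (isOneRow-support xs) ⟩
    T ℚ.* (1ℚ ℚ.* p x ℚ.* O) ∎
    where
    weight : O ≡ 0ℚ ⊎ sum xs ≡ 0 → T ℚ.* O ≡ T ℚ.* (1ℚ ℚ.* p x ℚ.* O)
    weight (inj₁ z) = cong (T ℚ.*_)
      (trans z (sym (trans (cong (1ℚ ℚ.* p x ℚ.*_) z) (ℚ.*-zeroʳ (1ℚ ℚ.* p x)))))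
    -- With a zero tail the head is e, which is positive, so its coefficient `p x` is 1 and can be
    -- inserted.
    weight (inj₂ z) = indicator-guard (x ℕ.+ sum xs ℕ.≟ e) λ q → sym (trans
      (cong (λ a → 1ℚ ℚ.* a ℚ.* O) (scaledMultiple-yes 1 x (1∣ x , ℕ.<-≤-trans e>0 (ℕ.≤-reflexive
        (trans (sym q) (trans (cong (x ℕ.+_) z) (ℕ.+-identityʳ x)))))))
      (ℚ.*-identityˡ O))

  there-case : ∑ℚ (upTo b) (λ j → indicator ((x ∷ xs) ≈ʳ? rowPower (suc j) e)) ≡ T ℚ.* (isZero x ℚ.* D)
  there-case = begin
    ∑ℚ (upTo b) (λ j → indicator ((x ∷ xs) ≈ʳ? rowPower (suc j) e))
      ≡⟨ ∑ℚ-cong (upTo b) (λ j → indicator-× ((x ∷ xs) ≈ʳ? rowPower (suc j) e) (x ℕ.≟ 0) (xs ≈ʳ? rowPower j e)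
           (λ p → p 0 , p ∘ suc) (λ { q ps zero → q ; q ps (suc k) → ps k })) ⟩
    ∑ℚ (upTo b) (λ j → isZero x ℚ.* indicator (xs ≈ʳ? rowPower j e))
      ≡⟨ ∑ℚ-*ˡ (isZero x) (λ j → indicator (xs ≈ʳ? rowPower j e)) (upTo b) ⟩
    isZero x ℚ.* ∑ℚ (upTo b) (λ j → indicator (xs ≈ʳ? rowPower j e))
      ≡⟨ cong (isZero x ℚ.*_) (∑-rowPower e e>0 (suc i) xs b len≤b) ⟩
    isZero x ℚ.* (indicator (sum xs ℕ.≟ e) ℚ.* D)
      ≡⟨ indicator-guard (x ℕ.≟ 0) (λ q → cong (λ y → indicator (y ℕ.+ sum xs ℕ.≟ e) ℚ.* D) (sym q)) ⟩
    isZero x ℚ.* (T ℚ.* D)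
      ≡⟨ solve 3 (λ a b c → a :* (b :* c) := b :* (a :* c)) refl (isZero x) T D ⟩
    T ℚ.* (isZero x ℚ.* D) ∎

module _ (d : ℕ) (d>0 : 0 < d) where

  private
    p : ℕ → ℚ
    p = scaledMultiple 1

    quotient>0 : ∀ n → suc n ∣ d → 0 < d / suc n
    quotient>0 n n∣d = m≥n⇒m/n>0 (∣⇒≤ {{ℕ.>-nonZero d>0}} n∣d)

    powers : ℕ → ℕ → ℕ → Monomial → ℚ
    powers w n i m = ∑ℚ (upTo w) (λ j → indicator (m ≈? variablePower i j (d / suc n)))

  -- P uses `n = i` only. The divisor n + 1 and the row i are kept apart because stripping a row
  -- lowers i but not the divisor; `w` is a column bound that stays fixed meanwhile.
  divisorTerm : ℕ → ℕ → ℕ → Monomial → ℚ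
  divisorTerm w n i m = indicator (suc n ∣? d) ℚ.* (fromℕ (suc n) ℚ.* powers w n i m)

  divisorTerm-[] : ∀ w n i → divisorTerm w n i [] ≡ 0ℚ
  divisorTerm-[] w n i = trans
    (indicator-guard (suc n ∣? d) λ n∣d → trans
      (cong (fromℕ (suc n) ℚ.*_) (trans
        (∑ℚ-cong (upTo w) (λ j → indicator-no ([] ≈? variablePower i j (d / suc n)) λ q →
          ℕ.<⇒≢ (quotient>0 n n∣d) (trans (q i j) (exponent-variablePower i j (d / suc n)))))
        (∑ℚ-zero (upTo w))))
      (ℚ.*-zeroʳ (fromℕ (suc n))))
    (ℚ.*-zeroʳ (indicator (suc n ∣? d)))

  -- That n + 1 divides d with quotient the row sum means that the row alone has degree d; as
  -- `isOne m` forces the other rows to vanish, this is the degree condition on the whole table.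
  divisorTerm-zero : ∀ w n row m → length row ≤ w →
    divisorTerm w n 0 (row ∷ m) ≡
    indicator (suc n ℕ.* sum row ℕ.+ degreeFrom (suc (suc n)) m ℕ.≟ d) ℚ.*
      (fromℕ (suc n) ℚ.* deriveRow p row ℚ.* isOne m)
  divisorTerm-zero w n row m len≤w = begin
    N ℚ.* (k ℚ.* powers w n 0 (row ∷ m))
      ≡⟨ indicator-guard (suc n ∣? d) (λ n∣d → cong (k ℚ.*_) (begin
           powers w n 0 (row ∷ m)
             ≡⟨ ∑ℚ-cong (upTo w) (λ j → trans
                  (indicator-× ((row ∷ m) ≈? variablePower 0 j e) (row ≈ʳ? rowPower j e) (All.all? (All.all? (ℕ._≟ 0)) m)
                    (λ q → q 0 , nth⇒All m (λ i → nth⇒All (nth [] m i) (q (suc i))))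
                    (λ { q zs zero → q ; q zs (suc i) → λ j → All⇒nth refl (All⇒nth [] zs i) j }))
                  (cong (indicator (row ≈ʳ? rowPower j e) ℚ.*_) (sym (isOne-indicator m)))) ⟩
           ∑ℚ (upTo w) (λ j → indicator (row ≈ʳ? rowPower j e) ℚ.* isOne m)
             ≡⟨ ∑ℚ-*ʳ (isOne m) (λ j → indicator (row ≈ʳ? rowPower j e)) (upTo w) ⟩
           ∑ℚ (upTo w) (λ j → indicator (row ≈ʳ? rowPower j e)) ℚ.* isOne m
             ≡⟨ cong (ℚ._* isOne m) (∑-rowPower e (quotient>0 n n∣d) 1 row w len≤w) ⟩
           indicator (sum row ℕ.≟ e) ℚ.* deriveRow p row ℚ.* isOne m ∎)) ⟩
    N ℚ.* (k ℚ.* (indicator (sum row ℕ.≟ e) ℚ.* deriveRow p row ℚ.* isOne m))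
      ≡⟨ solve 5 (λ N k s D o → N :* (k :* (s :* D :* o)) := ((N :* s) :* o) :* (k :* D)) refl
           N k (indicator (sum row ℕ.≟ e)) (deriveRow p row) (isOne m) ⟩
    ((N ℚ.* indicator (sum row ℕ.≟ e)) ℚ.* isOne m) ℚ.* (k ℚ.* deriveRow p row)
      ≡⟨ cong (λ i → (i ℚ.* isOne m) ℚ.* (k ℚ.* deriveRow p row)) (sym (indicator-× (suc n ℕ.* sum row ℕ.≟ d) (suc n ∣? d) (sum row ℕ.≟ e)
           (λ { refl → m∣m*n (sum row) , sym (trans (cong (_/ suc n) (ℕ.*-comm (suc n) (sum row))) (m*n/n≡m (sum row) (suc n))) })
           (λ n∣d q → trans (cong (suc n ℕ.*_) q) (trans (ℕ.*-comm (suc n) e) (m/n*n≡m n∣d))))) ⟩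
    (indicator (suc n ℕ.* sum row ℕ.≟ d) ℚ.* isOne m) ℚ.* (k ℚ.* deriveRow p row)
      ≡⟨ cong (ℚ._* (k ℚ.* deriveRow p row)) (guardedBySupport (suc n ℕ.* sum row ℕ.≟ d) (suc n ℕ.* sum row ℕ.+ W ℕ.≟ d)
           (isOne-supportFrom (suc (suc n)) m)
           (λ z q → trans (cong (suc n ℕ.* sum row ℕ.+_) z) (trans (ℕ.+-identityʳ _) q))
           (λ z q → trans (sym (ℕ.+-identityʳ _)) (trans (cong (suc n ℕ.* sum row ℕ.+_) (sym z)) q))) ⟩
    (I ℚ.* isOne m) ℚ.* (k ℚ.* deriveRow p row)
      ≡⟨ solve 4 (λ i o k D → (i :* o) :* (k :* D) := i :* (k :* D :* o)) refl I (isOne m) k (deriveRow p row) ⟩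
    I ℚ.* (k ℚ.* deriveRow p row ℚ.* isOne m) ∎
    where
    e = d / suc n
    k = fromℕ (suc n)
    N = indicator (suc n ∣? d)
    W = degreeFrom (suc (suc n)) m
    I = indicator (suc n ℕ.* sum row ℕ.+ W ℕ.≟ d)

  divisorTerm-suc : ∀ w n i row m →
    divisorTerm w n (suc i) (row ∷ m) ≡ isOneRow row ℚ.* divisorTerm w n i m
  divisorTerm-suc w n i row m = begin
    N ℚ.* (k ℚ.* powers w n (suc i) (row ∷ m))
      ≡⟨ cong (λ q → N ℚ.* (k ℚ.* q)) (trans
           (∑ℚ-cong (upTo w) (λ j → trans
             (indicator-× ((row ∷ m) ≈? variablePower (suc i) j e) (All.all? (ℕ._≟ 0) row) (m ≈? variablePower i j e)
               (λ q → nth⇒All row (q 0) , q ∘ suc)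
               (λ { zs q zero → All⇒nth refl zs ; zs q (suc k) → q k }))
             (cong (ℚ._* indicator (m ≈? variablePower i j e)) (sym (isOneRow-indicator row)))))
           (∑ℚ-*ˡ (isOneRow row) (λ j → indicator (m ≈? variablePower i j e)) (upTo w))) ⟩
    N ℚ.* (k ℚ.* (isOneRow row ℚ.* powers w n i m))
      ≡⟨ solve 4 (λ N k o q → N :* (k :* (o :* q)) := o :* (N :* (k :* q))) refl N k (isOneRow row) (powers w n i m) ⟩
    isOneRow row ℚ.* (N ℚ.* (k ℚ.* powers w n i m)) ∎
    where
    e = d / suc n
    k = fromℕ (suc n)
    N = indicator (suc n ∣? d)

  -- After k rows have been stripped, row i belongs to the divisor k + i + 1. A power in the head
  -- row gives the first summand of `derive`, a power in a later row the second.
  ∑-divisorTerm : ∀ w k m b → length m ≤ b → width m ≤ w →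
    ∑ℚ (upTo b) (λ i → divisorTerm w (k ℕ.+ i) i m) ≡
    indicator (degreeFrom (suc k) m ℕ.≟ d) ℚ.* deriveFrom p (suc k) m
  ∑-divisorTerm w k [] b _ _ = trans
    (∑ℚ-cong (upTo b) (λ i → divisorTerm-[] w (k ℕ.+ i) i))
    (trans (∑ℚ-zero (upTo b)) (sym (ℚ.*-zeroʳ (indicator (0 ℕ.≟ d)))))
  ∑-divisorTerm w k (row ∷ m) (suc b) (s≤s len≤b) width≤w = begin
    ∑ℚ (upTo (suc b)) (λ i → divisorTerm w (k ℕ.+ i) i (row ∷ m))
      ≡⟨ ∑ℚ-upTo-suc (λ i → divisorTerm w (k ℕ.+ i) i (row ∷ m)) b ⟩
    divisorTerm w (k ℕ.+ 0) 0 (row ∷ m) ℚ.+ ∑ℚ (upTo b) (λ i → divisorTerm w (k ℕ.+ suc i) (suc i) (row ∷ m))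
      ≡⟨ cong₂ ℚ._+_
           (trans (cong (λ n → divisorTerm w n 0 (row ∷ m)) (ℕ.+-identityʳ k))
             (divisorTerm-zero w k row m (ℕ.≤-trans (ℕ.m≤m⊔n (length row) (width m)) width≤w)))
           later ⟩
    I ℚ.* a ℚ.+ I ℚ.* (isOneRow row ℚ.* D)
      ≡⟨ sym (ℚ.*-distribˡ-+ I a (isOneRow row ℚ.* D)) ⟩
    I ℚ.* (a ℚ.+ isOneRow row ℚ.* D) ∎
    where
    I = indicator (suc k ℕ.* sum row ℕ.+ degreeFrom (suc (suc k)) m ℕ.≟ d)
    a = fromℕ (suc k) ℚ.* deriveRow p row ℚ.* isOne m
    D = deriveFrom p (suc (suc k)) m

    later : ∑ℚ (upTo b) (λ i → divisorTerm w (k ℕ.+ suc i) (suc i) (row ∷ m)) ≡ I ℚ.* (isOneRow row ℚ.* D)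
    later = begin
      ∑ℚ (upTo b) (λ i → divisorTerm w (k ℕ.+ suc i) (suc i) (row ∷ m))
        ≡⟨ ∑ℚ-cong (upTo b) (λ i → trans (divisorTerm-suc w (k ℕ.+ suc i) i row m)
             (cong (λ n → isOneRow row ℚ.* divisorTerm w n i m) (ℕ.+-suc k i))) ⟩
      ∑ℚ (upTo b) (λ i → isOneRow row ℚ.* divisorTerm w (suc k ℕ.+ i) i m)
        ≡⟨ ∑ℚ-*ˡ (isOneRow row) (λ i → divisorTerm w (suc k ℕ.+ i) i m) (upTo b) ⟩
      isOneRow row ℚ.* ∑ℚ (upTo b) (λ i → divisorTerm w (suc k ℕ.+ i) i m)
        ≡⟨ cong (isOneRow row ℚ.*_) (∑-divisorTerm w (suc k) m b len≤b
             (ℕ.≤-trans (ℕ.m≤n⊔m (length row) (width m)) width≤w)) ⟩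
      isOneRow row ℚ.* (indicator (W ℕ.≟ d) ℚ.* D)
        ≡⟨ solve 3 (λ o i D → o :* (i :* D) := (i :* o) :* D) refl (isOneRow row) (indicator (W ℕ.≟ d)) D ⟩
      (indicator (W ℕ.≟ d) ℚ.* isOneRow row) ℚ.* D
        ≡⟨ cong (ℚ._* D) (guardedBySupport (W ℕ.≟ d) (suc k ℕ.* sum row ℕ.+ W ℕ.≟ d) (isOneRow-support row)
             (λ z q → trans (cong (ℕ._+ W) (row≡0 z)) q)
             (λ z q → trans (cong (ℕ._+ W) (sym (row≡0 z))) q)) ⟩
      (I ℚ.* isOneRow row) ℚ.* D
        ≡⟨ ℚ.*-assoc I (isOneRow row) D ⟩
      I ℚ.* (isOneRow row ℚ.* D) ∎
      where
      W = degreeFrom (suc (suc k)) m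

      row≡0 : sum row ≡ 0 → suc k ℕ.* sum row ≡ 0
      row≡0 z = trans (cong (suc k ℕ.*_) z) (ℕ.*-zeroʳ (suc k))

  coeff-P : ∀ m → coeff (P d) m ≡ indicator (degree m ℕ.≟ d) ℚ.* deriveMonomial p m
  coeff-P m = begin
    coeff (P d) m
      ≡⟨ ∑ℚ-filter (λ i → suc (toℕ i) ∣? d)
           (λ i → coeff (weightedPowerSum (toℕ i) (d / suc (toℕ i)) (m≥n⇒m/n>0 (toℕ<n i))) m) (allFin d) ⟩
    ∑ℚ (allFin d) (λ i → indicator (suc (toℕ i) ∣? d) ℚ.*
      sumℚ (applyUpTo (λ j → fromℕ (suc (toℕ i)) ℚ.* indicator (m ≈? variablePower (toℕ i) j (d / suc (toℕ i)))) (width m)))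
      ≡⟨ ∑ℚ-cong (allFin d) (λ i → cong (indicator (suc (toℕ i) ∣? d) ℚ.*_) (trans
           (cong sumℚ (sym (map-upTo (λ j → fromℕ (suc (toℕ i)) ℚ.* indicator (m ≈? variablePower (toℕ i) j (d / suc (toℕ i)))) (width m))))
           (∑ℚ-*ˡ (fromℕ (suc (toℕ i))) (λ j → indicator (m ≈? variablePower (toℕ i) j (d / suc (toℕ i)))) (upTo (width m))))) ⟩
    ∑ℚ (allFin d) (λ i → G (toℕ i))
      ≡⟨ cong sumℚ (trans (map-tabulate id (G ∘ toℕ)) (tabulate-toℕ G d)) ⟩
    sumℚ (applyUpTo G d)
      -- The longer range reaches every row of `m`; the added indices i ≥ d give i + 1 > d, which
      -- cannot divide d.
      ≡⟨ sum-truncate G d (d ℕ.+ length m) beyond (ℕ.m≤m+n d (length m)) ⟩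
    sumℚ (applyUpTo G (d ℕ.+ length m))
      ≡⟨ cong sumℚ (sym (map-upTo G (d ℕ.+ length m))) ⟩
    ∑ℚ (upTo (d ℕ.+ length m)) G
      ≡⟨ ∑-divisorTerm (width m) 0 m (d ℕ.+ length m) (ℕ.m≤n+m (length m) d) ℕ.≤-refl ⟩
    indicator (degree m ℕ.≟ d) ℚ.* deriveMonomial p m ∎
    where
    G : ℕ → ℚ
    G i = divisorTerm (width m) i i m

    tabulate-toℕ : ∀ (f : ℕ → ℚ) n → tabulate {n = n} (f ∘ toℕ) ≡ applyUpTo f n
    tabulate-toℕ f zero    = refl
    tabulate-toℕ f (suc n) = cong (f 0 ∷_) (tabulate-toℕ (f ∘ suc) n)

    beyond : ∀ i → d ≤ i → G i ≡ 0ℚ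
    beyond i d≤i = trans
      (cong (ℚ._* (fromℕ (suc i) ℚ.* powers (width m) i i m))
        (indicator-no (suc i ∣? d) λ i∣d → ℕ.<⇒≱ (s≤s d≤i) (∣⇒≤ {{ℕ.>-nonZero d>0}} i∣d)))
      (ℚ.*-zeroˡ (fromℕ (suc i) ℚ.* powers (width m) i i m))

-- The sum over dyadic multiplicities.

ℓ-singular : ∀ k α → ℓ (replicate k [] ++ [ α ]) ≡ length α
ℓ-singular zero    α = ℕ.+-identityʳ (length α)
ℓ-singular (suc k) α = ℓ-singular k α

-- Each leading empty composition raises the current multiplicity by one, so the induction needs an
-- arbitrary starting multiplicity `k`.
E⁺-blocks-singular : ∀ p k .{{_ : NonZero k}} r .{{_ : NonZero r}} α → p ℕ.+ k ≡ r →
  map E⁺-block (blocksFrom k (replicate p [] ++ [ α ])) ≡ map (λ d → E⁺ d ⟨x^ r ⟩) α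
E⁺-blocks-singular zero    k r α refl =
  trans (cong (map E⁺-block) (++-identityʳ _)) (sym (map-∘ α))
E⁺-blocks-singular (suc p) k r α eq   =
  E⁺-blocks-singular p (suc k) r α (trans (ℕ.+-suc p k) eq)

dyadicTerm : SingularDyadic → Monomial → ℚ
dyadicTerm δ = coeff (fromℤ ((-1ℤ ℤ.^ (ℓ (toPolycomposition δ) ℕ.∸ 1)) ℤ.* (+ L δ)) •
                      E⁺-poly (toPolycomposition δ))

dyadicTerm-compositionTerm : ∀ c j m →
  dyadicTerm (c ^2^ j) m ≡ compositionTerm (2 ^ j) {{ℕ.m^n≢0 2 j}} c m
dyadicTerm-compositionTerm c j m = cong₂ (λ n s → fromℤ ((-1ℤ ℤ.^ (n ℕ.∸ 1)) ℤ.* (+ L (c ^2^ j))) ℚ.* coeff (∏ s) m)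
  (ℓ-singular (pred (2 ^ j)) (toList c))
  (E⁺-blocks-singular (pred (2 ^ j)) 1 (2 ^ j) {{ℕ.m^n≢0 2 j}} (toList c)
    (trans (ℕ.+-comm (pred (2 ^ j)) 1) (ℕ.suc-pred (2 ^ j) {{ℕ.m^n≢0 2 j}})))

∑-nonEmptyCompositions : ∀ r .{{_ : NonZero r}} n → 0 < n → ∀ m →
  ∑ℚ (nonEmptyCompositions n) (λ c → compositionTerm r c m) ≡
  indicator (degree m ℕ.≟ r ℕ.* n) ℚ.* deriveMonomial (signedMultiple r) m
∑-nonEmptyCompositions r (suc n) _ = ∑-compositions r n

-- The divisibility test of the enumeration disappears on the right, because the derivation for 2^j
-- is supported in degrees divisible by 2^j. All exponents j then contribute uniformly, as
-- telescoping demands.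
∑-withExponent : ∀ d → 0 < d → ∀ j m →
  indicator (2 ^ j ∣? d) ℚ.* ∑ℚ (withExponent d j) (λ δ → dyadicTerm δ m) ≡
  indicator (degree m ℕ.≟ d) ℚ.* deriveMonomial (signedMultiple (2 ^ j)) m
∑-withExponent d d>0 j m = begin
  N ℚ.* ∑ℚ (withExponent d j) (λ δ → dyadicTerm δ m)
    ≡⟨ cong (N ℚ.*_) (trans (∑ℚ-map (λ δ → dyadicTerm δ m) (_^2^ j) (nonEmptyCompositions (d / 2 ^ j)))
         (∑ℚ-cong (nonEmptyCompositions (d / 2 ^ j)) (λ c → dyadicTerm-compositionTerm c j m))) ⟩
  N ℚ.* ∑ℚ (nonEmptyCompositions (d / 2 ^ j)) (λ c → compositionTerm (2 ^ j) c m)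
    ≡⟨ indicator-guard (2 ^ j ∣? d) (λ r∣d → trans
         (∑-nonEmptyCompositions (2 ^ j) (d / 2 ^ j) (m≥n⇒m/n>0 (∣⇒≤ {{ℕ.>-nonZero d>0}} r∣d)) m)
         (cong (λ n → indicator (degree m ℕ.≟ n) ℚ.* D) (trans (ℕ.*-comm (2 ^ j) (d / 2 ^ j)) (m/n*n≡m r∣d)))) ⟩
  N ℚ.* (I ℚ.* D)
    ≡⟨ solve 3 (λ n i D → n :* (i :* D) := i :* (n :* D)) refl N I D ⟩
  I ℚ.* (N ℚ.* D)
    ≡⟨ indicator-guard (degree m ℕ.≟ d) (λ deg → dropDivisibility deg (deriveMonomial-support (2 ^ j) (signedMultiple-support (2 ^ j)) m)) ⟩
  I ℚ.* D ∎
  where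
  instance r≢0 = ℕ.m^n≢0 2 j
  N = indicator (2 ^ j ∣? d)
  I = indicator (degree m ℕ.≟ d)
  D = deriveMonomial (signedMultiple (2 ^ j)) m

  dropDivisibility : degree m ≡ d → D ≡ 0ℚ ⊎ PositiveMultiple (2 ^ j) (degree m) → N ℚ.* D ≡ D
  dropDivisibility deg (inj₁ z)         = trans (cong (N ℚ.*_) z) (trans (ℚ.*-zeroʳ N) (sym z))
  dropDivisibility deg (inj₂ (r∣m , _)) = trans
    (cong (ℚ._* D) (indicator-yes (2 ^ j ∣? d) (subst (2 ^ j ∣_) deg r∣m))) (ℚ.*-identityˡ D)

proposition31 : ∀ (d : ℕ) → 1 ≤ d →
    P d ≋ ∑ (PCom*dyad d) (λ δ →
    fromℤ ((-1ℤ ^ℤ (ℓ (toPolycomposition δ) ∸ 1)) *ℤ (+ L δ)) • E⁺-poly (toPolycomposition δ))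
proposition31 d d>0 m = sym (begin
  ∑ℚ (PCom*dyad d) F
    ≡⟨ ∑ℚ-concat F (map (withExponent d) (filter (λ j → 2 ^ j ∣? d) (upTo d))) ⟩
  ∑ℚ (map (withExponent d) (filter (λ j → 2 ^ j ∣? d) (upTo d))) (λ δs → ∑ℚ δs F)
    ≡⟨ ∑ℚ-map (λ δs → ∑ℚ δs F) (withExponent d) (filter (λ j → 2 ^ j ∣? d) (upTo d)) ⟩
  ∑ℚ (filter (λ j → 2 ^ j ∣? d) (upTo d)) (λ j → ∑ℚ (withExponent d j) F)
    ≡⟨ ∑ℚ-filter (λ j → 2 ^ j ∣? d) (λ j → ∑ℚ (withExponent d j) F) (upTo d) ⟩
  ∑ℚ (upTo d) (λ j → indicator (2 ^ j ∣? d) ℚ.* ∑ℚ (withExponent d j) F)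
    -- Since 2 * 2^j is 2^(j+1) by definition, `signedMultiple (2 ^ j)` is already a difference of
    -- consecutive terms.
    ≡⟨ ∑ℚ-cong (upTo d) (λ j → trans (∑-withExponent d d>0 j m)
         (cong (I ℚ.*_) (deriveMonomial-minus (scaledMultiple (2 ^ j)) (scaledMultiple (2 ^ suc j)) m))) ⟩
  ∑ℚ (upTo d) (λ j → I ℚ.* (H j ℚ.- H (suc j)))
    ≡⟨ ∑ℚ-*ˡ I (λ j → H j ℚ.- H (suc j)) (upTo d) ⟩
  I ℚ.* ∑ℚ (upTo d) (λ j → H j ℚ.- H (suc j))
    ≡⟨ cong (I ℚ.*_) (∑ℚ-telescope H d) ⟩
  I ℚ.* (H 0 ℚ.- H d)
    -- `H d` lives in positive degrees divisible by 2^d, which exceeds d, so it vanishes in degree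
    -- d; what remains is the case of multiplicity 2^0 = 1.
    ≡⟨ indicator-guard (degree m ℕ.≟ d) (λ deg → trans
         (cong (λ q → H 0 ℚ.- q) (top deg (deriveMonomial-support (2 ^ d) (scaledMultiple-support (2 ^ d)) m)))
         (ℚ.+-identityʳ (H 0))) ⟩
  I ℚ.* H 0
    ≡⟨ sym (coeff-P d d>0 m) ⟩
  coeff (P d) m ∎)
  where
  F : SingularDyadic → ℚ
  F δ = dyadicTerm δ m

  H : ℕ → ℚ
  H j = deriveMonomial (scaledMultiple (2 ^ j)) m

  I = indicator (degree m ℕ.≟ d)

  top : degree m ≡ d → H d ≡ 0ℚ ⊎ PositiveMultiple (2 ^ d) (degree m) → H d ≡ 0ℚ
  top deg (inj₁ z)         = z
  top deg (inj₂ (r∣m , pos)) = contradiction (∣⇒≤ {{ℕ.>-nonZero pos}} r∣m)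
    (ℕ.<⇒≱ (subst (_< 2 ^ d) (sym deg) (n<2^n d)))
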